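{- Let $\mathcal{K}$ be a semi-equivelar map of type $X$ on a surface with Euler characteristic $-2$. Then for every $m = 2, 3, 4, \dots$ there exists a semi-equivelar map $\mathcal{K}^m$ of type $X$ (an $m$-covering map of $\mathcal{K}$) on a surface with Euler characteristic $\chi = -2m$.
   Context: A surface is a connected closed 2-manifold (orientable or not). A map is a connected 2-dimensional cell complex on a surface (equivalently, a cellular embedding of a connected graph). All maps are polyhedral: a non-empty intersection of two distinct faces is either a vertex or an edge. Face-cycle, type: the faces containing a vertex $u$ form a cycle (the face-cycle at $u$) of the form $(F_{1,1}-\cdots-F_{1,n_1})-\cdots-(F_{k,1}-\cdots-F_{k,n_k})-F_{1,1}$, where $F_{i,\ell}$ is a $p_i$-gon for $1\le \ell\le n_i$, $1\le i\le k$, $p_r\ne p_{r+1}$ for $1\le r\le k-1$ and $p_k\ne p_1$ (if $k>1$). A map is semi-equivelar of type $[p_1^{n_1},\dots,p_k^{n_k}]$ ($p_i\ge 3$, $n_i\ge1$) if the face-cycle at every vertex has this form with the same cyclic sequence; types are considered up to cyclic rotation and reversal. Link: the vertices of the faces around $u$, other than $u$, form a cycle around $u$ (the link-cycle of $u$), bounding the disk that is the union of the faces at $u$. Cycles: a cycle in a map is contractible if it bounds a 2-disk; genus-separating if it does not bound a 2-disk but separates the surface; non-trivial if it neither bounds a 2-disk nor is genus-separating. $\ell$-covering map $\mathcal{K}^{\ell}$: let $C$ be a non-trivial cycle of length $k$ in $\mathcal{K}$ which divides the face-cycles of its vertices, i.e. for every sub-path $u-v-w$ of length two of $C$, the path $u-v-w$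 is a chord of the disk formed by the faces at $v$ (it splits the face-cycle of $v$ into faces on the two sides of $C$). Cut $\mathcal{K}$ along $C$ to get a map $\mathcal{M}$ with two boundary cycles $A(p_1,\dots,p_k)$ and $B(q_1,\dots,q_k)$, where $p_i$ and $q_i$ come from the same vertex of $C$. Take $\ell$ copies $\mathcal{M}_1,\dots,\mathcal{M}_\ell$ of $\mathcal{M}$ with boundary cycles $A_i(p^i_1,\dots,p^i_k)$ and $B_i(q^i_1,\dots,q^i_k)$, and identify $B_i$ with $A_{i+1}$ via $q^i_j\mapsto p^{i+1}_j$ for $1\le i\le \ell$ (indices $i$ modulo $\ell$). The resulting map is called an $\ell$-covering map $\mathcal{K}^\ell$ of $\mathcal{K}$. -}

module Defs where

open import Data.Fin using (Fin; toℕ; _≟_)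
open import Data.Fin.Properties using (any?)
open import Data.Fin.Subset using (Subset; _∈_; _∉_; ∣_∣)
open import Data.Integer using (ℤ; +_) renaming (_+_ to _+ℤ_; _-_ to _-ℤ_)
open import Data.List using (List; _++_; concat; replicate; reverse; tabulate)
open import Data.Nat using (ℕ; suc; _≤_; _<_)
open import Data.Nat.DivMod using (_mod_)
open import Data.Product using (∃-syntax; _×_; _,_)
open import Data.Sum using (_⊎_)
open import Function.Bundles using (_⇔_; _⤖_; module Bijection)
open import Function.Definitions using (Injective; Surjective)
open import Relation.Binary.Construct.Closure.Equivalence using (EqClosure)
open import Relation.Binary.Construct.Closure.ReflexiveTransitive using (Star)
open import Relation.Binary.PropositionalEquality using (_≡_; _≢_)
open import Relation.Nullary using (¬_; Dec; yes; no)

-- i ↦ i + 1 modulo n.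
next : ∀ {n} → Fin n → Fin n
next {suc n} i = suc (toℕ i) mod suc n

Rotation : ∀ {A : Set} → List A → List A → Set
Rotation xs ys = ∃[ as ] ∃[ bs ] (xs ≡ as ++ bs × ys ≡ bs ++ as)

-- Equality of cyclic sequences up to rotation and reversal.
_≈ᶜ_ : ∀ {A : Set} → List A → List A → Set
xs ≈ᶜ ys = Rotation xs ys ⊎ Rotation (reverse xs) ys

-- Raw incidence data: vertices, edges and polygonal faces, where a face f is a
-- (size f)-gon with boundary cycle  boundary f 0 - boundary f 1 - ⋯ .
record CellComplex : Set where
  field
    nV nE nF : ℕ
    ends     : Fin nE → Fin nV × Fin nV
    size     : Fin nF → ℕ
    boundary : (f : Fin nF) → Fin (size f) → Fin nV

  Vertex Edge Face : Set
  Vertex = Fin nV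
  Edge   = Fin nE
  Face   = Fin nF

  -- Edges are undirected: the order of the two components of  ends e  carries
  -- no information.
  Joins : Edge → Vertex → Vertex → Set
  Joins e u v = (ends e ≡ (u , v)) ⊎ (ends e ≡ (v , u))

  _∈ᵉ_ : Vertex → Edge → Set
  u ∈ᵉ e = ∃[ v ] Joins e u v

  _∈ᶠ_ : Vertex → Face → Set
  u ∈ᶠ f = ∃[ i ] boundary f i ≡ u

  _⊂ᶠ_ : Edge → Face → Set
  e ⊂ᶠ f = ∃[ i ] Joins e (boundary f i) (boundary f (next i))

  Adjacent : Vertex → Vertex → Set
  Adjacent u v = ∃[ e ] Joins e u v

  -- f and g are the two faces on either side of e.
  Across : Edge → Face → Face → Set
  Across e f g = f ≢ g × e ⊂ᶠ f × e ⊂ᶠ g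

  χ : ℤ
  χ = (+ nV -ℤ + nE) +ℤ + nF

-- A polyhedral map on a surface.  Closed faces are embedded polygons, and the
-- space is a closed 2-manifold because the faces around every vertex u form one
-- cycle  star u 0 - star u 1 - ⋯ - star u 0,  in which  star u i  lies between
-- the edges  spoke u i  and  spoke u (i + 1).
record PolyhedralMap : Set where
  field
    complex : CellComplex

  open CellComplex complex public

  field
    loopless           : ∀ e u → ¬ Joins e u u
    simple             : ∀ e e′ u v → Joins e u v → Joins e′ u v → e ≡ e′
    size≥3             : ∀ f → 3 ≤ size f
    boundary-injective : ∀ f → Injective _≡_ _≡_ (boundary f)
    boundary-edges     : ∀ f i → Adjacent (boundary f i) (boundary f (next i))
    edge-in-face       : ∀ e → ∃[ f ] e ⊂ᶠ f

    degree          : Vertex → ℕ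
    degree≥3        : ∀ u → 3 ≤ degree u
    star            : (u : Vertex) → Fin (degree u) → Face
    spoke           : (u : Vertex) → Fin (degree u) → Edge
    star-injective  : ∀ u → Injective _≡_ _≡_ (star u)
    star-complete   : ∀ u f → u ∈ᶠ f → ∃[ i ] star u i ≡ f
    spoke-injective : ∀ u → Injective _≡_ _≡_ (spoke u)
    spoke-incident  : ∀ u i → u ∈ᵉ spoke u i
    spoke-first     : ∀ u i → spoke u i ⊂ᶠ star u i
    spoke-second    : ∀ u i → spoke u (next i) ⊂ᶠ star u i

    nonempty  : 0 < nV
    connected : ∀ u v → Star Adjacent u v

    -- Two distinct faces with a common vertex u meet exactly in u, or exactly
    -- in a common edge.
    polyhedral :
      ∀ f g → f ≢ g → ∀ u → u ∈ᶠ f → u ∈ᶠ g →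
        (∀ w → w ∈ᶠ f → w ∈ᶠ g → w ≡ u)
        ⊎ (∃[ e ] (e ⊂ᶠ f × e ⊂ᶠ g × (∀ w → w ∈ᶠ f → w ∈ᶠ g → w ∈ᵉ e)))

-- A type [p₁^n₁, …, p_k^n_k]; adjacent terms (cyclically) have different p.
record VertexType : Set where
  field
    k        : ℕ
    p n      : Fin k → ℕ
    k≥1      : 1 ≤ k
    p≥3      : ∀ r → 3 ≤ p r
    n≥1      : ∀ r → 1 ≤ n r
    distinct : 1 < k → ∀ r → p r ≢ p (next r)

  sequence : List ℕ
  sequence = concat (tabulate λ r → replicate (n r) (p r))

IsSemiEquivelar : VertexType → PolyhedralMap → Set
IsSemiEquivelar X K =
  ∀ u → tabulate (λ i → size (star u i)) ≈ᶜ VertexType.sequence X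
  where open PolyhedralMap K

module _ (K : PolyhedralMap) where
  open PolyhedralMap K

  record Cycle : Set where
    field
      length    : ℕ
      length≥3  : 3 ≤ length
      at        : Fin length → Vertex
      injective : Injective _≡_ _≡_ at
      adjacent  : ∀ j → Adjacent (at j) (at (next j))

    OnCycle : Vertex → Set
    OnCycle v = ∃[ j ] at j ≡ v

    EdgeOf : Edge → Set
    EdgeOf e = ∃[ j ] Joins e (at j) (at (next j))

  module _ (C : Cycle) where
    open Cycle C

    -- The faces in D form a disk with boundary C.  Since exactly the edges of C
    -- have one side in D and C is a simple cycle, the union of D is a surface
    -- with the single boundary cycle C; it is a disk when it is connected and
    -- has Euler characteristic 1.  VD and ED are its vertices and edges.
    record BoundsDisk : Set where
      field
        D  : Subset nF
        VD : Subset nV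
        ED : Subset nE
        vertices : ∀ v → v ∈ VD ⇔ (∃[ f ] (f ∈ D × v ∈ᶠ f))
        edges    : ∀ e → e ∈ ED ⇔ (∃[ f ] (f ∈ D × e ⊂ᶠ f))
        boundary-is-C : ∀ e f g → Across e f g →
          EdgeOf e ⇔ ((f ∈ D × g ∉ D) ⊎ (f ∉ D × g ∈ D))
        D-connected : ∀ f g → f ∈ D → g ∈ D →
          Star (λ f′ g′ → f′ ∈ D × g′ ∈ D × (∃[ e ] Across e f′ g′)) f g
        χ-D : (+ ∣ VD ∣ -ℤ + ∣ ED ∣) +ℤ + ∣ D ∣ ≡ + 1

    -- The complement of C is disconnected: some two faces cannot be joined by
    -- a chain of faces that only crosses edges outside C.
    Separates : Set
    Separates = ∃[ f ] ∃[ g ]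
      (¬ Star (λ f′ g′ → ∃[ e ] (Across e f′ g′ × ¬ EdgeOf e)) f g)

    Contractible : Set
    Contractible = BoundsDisk

    GenusSeparating : Set
    GenusSeparating = ¬ BoundsDisk × Separates

    NonTrivial : Set
    NonTrivial = ¬ Contractible × ¬ GenusSeparating

    -- For every sub-path u - v - w of C, the edges vu and vw are two different
    -- spokes  spoke v i  and  spoke v i′,  so they split the face-cycle of v.
    DividesFaceCycles : Set
    DividesFaceCycles = ∀ j →
      let u = at j ; v = at (next j) ; w = at (next (next j)) in
      ∃[ i ] ∃[ i′ ] (i ≢ i′ × Joins (spoke v i) v u × Joins (spoke v i′) v w)

    data Side : Set where
      A B : Side

    -- How to cut K along C: each face at a vertex  at j  of C is put on the
    -- A-side or the B-side of C there.  Such a choice exists exactly when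
    -- cutting along C produces two boundary cycles rather than one.
    record Cut : Set where
      field
        -- Only meaningful for faces f containing  at j .
        side     : Fin length → Face → Side
        opposite : ∀ j e f g → Across e f g → at j ∈ᵉ e →
                   EdgeOf e → side j f ≢ side j g
        same     : ∀ j e f g → Across e f g → at j ∈ᵉ e →
                   ¬ EdgeOf e → side j f ≡ side j g
        along    : ∀ j e f → e ⊂ᶠ f → Joins e (at j) (at (next j)) →
                   side j f ≡ side (next j) f

    -- The vertices of the map M obtained from K by cutting along C: those of K
    -- off C, and the boundary cycles A(p₁,…,p_k) and B(q₁,…,q_k).
    data CutVertex : Set where
      inner : (v : Vertex) → .(¬ OnCycle v) → CutVertex
      p q   : Fin length → CutVertex

    module _ (cut : Cut) where
      open Cut cut

      onSide : Side → Fin length → CutVertex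
      onSide A j = p j
      onSide B j = q j

      relabel : Face → (v : Vertex) → Dec (OnCycle v) → CutVertex
      relabel f v (yes (j , _)) = onSide (side j f) j
      relabel f v (no v∉C)      = inner v v∉C

      -- The boundary cycle in M of the face f.
      cutBoundary : (f : Face) → Fin (size f) → CutVertex
      cutBoundary f i =
        relabel f (boundary f i) (any? (λ j → at j ≟ boundary f i))

    data Glue {m : ℕ} : Fin m × CutVertex → Fin m × CutVertex → Set where
      glue : ∀ i j → Glue (i , q j) (next i , p j)

-- L is the m-covering map of K obtained from m copies of M (K cut along C) by
-- identifying qⁱⱼ with pⁱ⁺¹ⱼ: its vertices are the classes of the vertices of the
-- copies under the identification, and its faces are the faces of the copies.
record IsCoveringMap (m : ℕ) (K L : PolyhedralMap) : Set where
  private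
    module K = PolyhedralMap K
    module L = PolyhedralMap L
  field
    C          : Cycle K
    nontrivial : NonTrivial K C
    divides    : DividesFaceCycles K C
    cut        : Cut K C

    vertexMap            : Fin m × CutVertex K C → L.Vertex
    vertexMap-surjective : Surjective _≡_ _≡_ vertexMap
    vertexMap-kernel     : ∀ x y → vertexMap x ≡ vertexMap y ⇔ EqClosure (Glue K C) x y

    faceMap : (Fin m × K.Face) ⤖ L.Face

  onFaces : Fin m × K.Face → L.Face
  onFaces = Bijection.to faceMap

  field
    faceMap-boundary : ∀ i f →
      tabulate (L.boundary (onFaces (i , f)))
        ≈ᶜ tabulate (λ j → vertexMap (i , cutBoundary K C cut f j))

{-# OPTIONS --safe #-}
module Submission where

-- Cyclic covers of polyhedral maps are polyhedral of the same type, so everything rests on finding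
-- a two-sided, non-separating cycle C in K.  A mod 2 cocycle ψ which is odd on C certifies that C
-- does not separate, and C is two-sided as soon as it crosses an even number of twisted edges
-- (edges along which the vertex orientations disagree).  Since E = V + F + 2, linear algebra over
-- 𝔽₂ provides a cocycle ψ such that neither ψ nor ψ + twist is a coboundary.  In a 2-connected
-- graph such a pair always has a simple cycle with even twist and odd ψ: starting from a cycle with
-- odd twist on which ψ + b · twist vanishes, attach ears (they are found on face boundaries); the
-- subgraph obtained so far joins any two of its nodes by simple paths of both twist parities on
-- which ψ + b · twist is a potential difference, so the first ear violating the potential closes
-- up to the desired cycle, and if none does then ψ + b · twist is a coboundary.

open import Defs
open import Data.Nat using (ℕ; _≤_; _*_)
open import Data.Integer using (+_; -_)
open import Data.Product using (∃-syntax; _×_)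
open import Relation.Binary.PropositionalEquality using (_≡_)

open import Algebra.Bundles using (CommutativeRing)
open import Data.Bool as Bool using (Bool; true; false; not; _xor_; _∧_)
open import Data.Bool.Properties using (xor-∧-commutativeRing; xor-assoc; xor-comm; xor-same; xor-identityʳ; ∧-identityʳ; ∧-zeroʳ; ∧-distribˡ-xor; ∧-distribʳ-xor; not-involutive; not-distribˡ-xor)
open import Data.Bool.Solver using (module xor-∧-Solver)
open import Data.Empty using (⊥-elim; ⊥-elim-irr)
open import Data.Fin using (Fin; zero; suc; _≟_; toℕ; fromℕ; fromℕ<; inject₁; combine; remQuot; finToFun; funToFin; splitAt; _↑ˡ_; _↑ʳ_)
open import Data.Fin.Induction using (<-weakInduction; >-weakInduction)
open import Data.Fin.Properties using (toℕ-injective; toℕ-fromℕ; toℕ-inject₁; toℕ-fromℕ<; toℕ<n; suc-injective; any?; all?; ¬∀⟶∃¬; pigeonhole; funToFin-finToFin; finToFun-funToFin; splitAt-↑ˡ; splitAt-↑ʳ; remQuot-combine; combine-remQuot; combine-injective; *↔×)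
open import Data.Fin.Relation.Unary.Top using (view; ‵fromℕ; ‵inject₁)
open import Data.Fin.Subset using (Subset; _∈_; _∉_; _∪_; ⁅_⁆; _⊃_; _⊆_) renaming (⊥ to ∅)
open import Data.Fin.Subset.Induction using (⊃-wellFounded; Acc; acc)
open import Data.Fin.Subset.Properties using (_∈?_; x∈p∪q⁻; x∈p∪q⁺; x∈⁅x⁆; x∈⁅y⁆⇒x≡y; ∉⊥)
import Data.Integer as ℤ
import Data.Integer.Properties as ℤ
open import Data.Integer.Tactic.RingSolver using (solve-∀)
open import Data.List using (List; []; _∷_; _++_; _∷ʳ_; reverse; foldr; length; lookup; tabulate)
open import Data.List.Membership.Propositional using () renaming (_∈_ to _∈ˡ_; _∉_ to _∉ˡ_)
open import Data.List.Membership.Propositional.Properties using (∈-∃++; ∈-++⁺ˡ; ∈-++⁺ʳ; ∈-++⁻; ∈-lookup)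
open import Data.List.Properties using (unfold-reverse; ++-assoc; ++-identityʳ; tabulate-cong)
open import Data.List.Relation.Binary.Disjoint.Propositional using (Disjoint)
open import Data.List.Relation.Binary.Permutation.Propositional using (_↭_; ↭-sym; ↭-trans; ↭-refl; prep; swap; ↭⇒↭ₛ)
open import Data.List.Relation.Binary.Permutation.Propositional.Properties as Perm using (↭-reverse; All-resp-↭; ∈-resp-↭)
import Data.List.Relation.Binary.Permutation.Setoid.Properties as Permₛ
open import Data.List.Relation.Unary.All as All using (All; []; _∷_)
import Data.List.Relation.Unary.All.Properties as All
open import Data.List.Relation.Unary.AllPairs as AllPairs using ([]; _∷_)
open import Data.List.Relation.Unary.Any using (Any; here; there)
import Data.List.Relation.Unary.Any.Properties as Any
open import Data.List.Relation.Unary.Unique.Propositional using (Unique)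
open import Data.List.Relation.Unary.Unique.Propositional.Properties using (++⁺; tabulate⁺; Unique[x∷xs]⇒x∉xs)
open import Data.Nat as ℕ using (zero; suc; _+_; _<_; _^_; z≤n; s≤s)
open import Data.Nat.DivMod using (_%_; m<n⇒m%n≡m; n%n≡0)
open import Data.Nat.Properties as ℕ using (≤-refl; ≤-trans; ≤-antisym; ≤-total; ≤-pred; ≤∧≢⇒<; <-≤-trans; <⇒≢; n≤1+n; m≤n⇒m≤1+n; m≤m+n; 1+n≰n; 0≢1+n; n≤0⇒n≡0; ^-monoʳ-<; +-suc; +-comm)
open import Data.Product using (Σ; ∃₂; _,_; proj₁; proj₂)
open import Data.Product.Properties using (≡-dec)
open import Data.Sum as Sum using (_⊎_; inj₁; inj₂; [_,_]′)
open import Data.Unit using (⊤; tt)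
open import Data.Vec as Vec using (Vec; []; _∷_; zipWith)
open import Data.Vec.Properties using (lookup-zipWith; lookup∘tabulate)
open import Function using (_∘_; id)
open import Function.Bundles using (mk⇔; Equivalence)
open import Function.Properties.Inverse using (↔⇒⤖; ↔-sym)
open import Relation.Binary.Construct.Closure.Equivalence as EqClosure using (EqClosure)
open import Relation.Binary.Construct.Closure.ReflexiveTransitive as Star using (Star; ε; _◅_; _◅◅_)
open import Relation.Binary.Construct.Closure.Symmetric using (fwd; bwd)
open import Relation.Binary.PropositionalEquality using (_≢_; refl; sym; trans; cong; cong₂; subst; subst₂; setoid; module ≡-Reasoning)
open import Relation.Nullary using (¬_; Dec; yes; no; does)
open import Relation.Nullary.Decidable using (_→-dec_; _×-dec_; _⊎-dec_; ¬?; decidable-stable; does-⇔; dec-true; dec-false)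
open import Algebra.Properties.Semiring.Sum (CommutativeRing.semiring xor-∧-commutativeRing) using (sum; sum-cong-≗; sum-init-last; ∑-comm; ∑-distrib-+; *-distribˡ-sum; sum-replicate-zero)
open xor-∧-Solver using (solve; _:+_; _:=_)

-- The obstacle is non-orientability: a non-separating cycle may be one-sided, and cutting along it
-- gives one boundary cycle instead of two. Modulo 2 both demands on C are linear (`twist` even, ψ
-- odd), but C must also be a simple cycle of the graph, and a homology class with these values need
-- not be carried by one; hence ears instead of pure algebra. Why -2 suffices: there are `nF`
-- cocycle conditions, and the functions to avoid, coboundaries plus multiples of `twist`, are
-- parametrised by `nV + 1` bits. Asking ψ to vanish at `nV + 1` pivot edges of this parametrisation
-- puts any nonzero solution outside the family, and `nE` still exceeds the number of equations by
-- one. No rank or homology group is ever computed. Why the cover inherits everything: faces are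
-- embedded polygons and the star of a vertex lifts as a whole, so stars and intersections of faces
-- are those of K. Connectedness is the global point: C does not separate, so each sheet is
-- connected, and crossing C leads to the next sheet.

-- Cyclic successor on `Fin n`.

next-inject₁ : ∀ {n} (i : Fin n) → next (inject₁ i) ≡ suc i
next-inject₁ {n} i = toℕ-injective (begin
  toℕ (next (inject₁ i))         ≡⟨ toℕ-fromℕ< _ ⟩
  suc (toℕ (inject₁ i)) % suc n  ≡⟨ cong (λ k → suc k % suc n) (toℕ-inject₁ i) ⟩
  suc (toℕ i) % suc n            ≡⟨ m<n⇒m%n≡m (s≤s (toℕ<n i)) ⟩
  suc (toℕ i)                    ∎)
  where open ≡-Reasoning

next-fromℕ : ∀ n → next (fromℕ n) ≡ zero
next-fromℕ n = toℕ-injective (begin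
  toℕ (next (fromℕ n))         ≡⟨ toℕ-fromℕ< _ ⟩
  suc (toℕ (fromℕ n)) % suc n  ≡⟨ cong (λ k → suc k % suc n) (toℕ-fromℕ n) ⟩
  suc n % suc n                ≡⟨ n%n≡0 (suc n) ⟩
  0                            ∎)
  where open ≡-Reasoning

toℕ-next : ∀ {n} (i : Fin n) →
           toℕ (next i) ≡ suc (toℕ i) ⊎ (toℕ (next i) ≡ 0 × suc (toℕ i) ≡ n)
toℕ-next {suc n} i with view i
... | ‵fromℕ     = inj₂ (cong toℕ (next-fromℕ n) , cong suc (toℕ-fromℕ n))
... | ‵inject₁ j = inj₁ (trans (cong toℕ (next-inject₁ j)) (cong suc (sym (toℕ-inject₁ j))))

-- From `i` climb to the last index and wrap to zero; from zero every index is reached.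
next-induction : ∀ {n} (P : Fin n → Set) {i} → P i → (∀ j → P j → P (next j)) → ∀ j → P j
next-induction {suc n} P {i} Pi step =
  <-weakInduction P (to-zero i Pi) (λ j Pj → subst P (next-inject₁ j) (step _ Pj))
  where
  to-zero : ∀ j → P j → P zero
  to-zero = >-weakInduction (λ j → P j → P zero)
    (λ Pj → subst P (next-fromℕ n) (step _ Pj))
    (λ j ih Pj → ih (subst P (next-inject₁ j) (step _ Pj)))

prev : ∀ {n} → Fin n → Fin n
prev {suc n} zero    = fromℕ n
prev {suc n} (suc i) = inject₁ i

next-prev : ∀ {n} (i : Fin n) → next (prev i) ≡ i
next-prev {suc n} zero    = next-fromℕ n
next-prev {suc n} (suc i) = next-inject₁ i

prev-next : ∀ {n} (i : Fin n) → prev (next i) ≡ i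
prev-next {suc n} i with view i
... | ‵fromℕ     = cong prev (next-fromℕ n)
... | ‵inject₁ j = cong prev (next-inject₁ j)

next-injective : ∀ {n} {i j : Fin n} → next i ≡ next j → i ≡ j
next-injective {i = i} {j} eq = trans (sym (prev-next i)) (trans (cong prev eq) (prev-next j))

next≢ : ∀ {n} → 2 ≤ n → (i : Fin n) → next i ≢ i
next≢ 2≤n i eq with toℕ-next i
... | inj₁ e        = <⇒≢ (s≤s (≤-refl)) (trans (cong toℕ (sym eq)) e)
next≢ (s≤s (s≤s _)) i eq | inj₂ (e , e′) with trans (cong suc (trans (sym e) (cong toℕ eq))) e′
... | ()

next²≢ : ∀ {n} → 3 ≤ n → (i : Fin n) → next (next i) ≢ i
next²≢ 3≤n i eq with toℕ-next i | toℕ-next (next i)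
... | inj₁ e | inj₁ e′ = <⇒≢ (m≤n⇒m≤1+n ≤-refl)
  (trans (cong toℕ (sym eq)) (trans e′ (cong suc e)))
next²≢ (s≤s (s≤s (s≤s _))) i eq | inj₁ e | inj₂ (e′ , e″)
  with trans (cong (λ k → suc (suc k)) (trans (sym e′) (cong toℕ eq))) (trans (cong suc (sym e)) e″)
... | ()
next²≢ (s≤s (s≤s (s≤s _))) i eq | inj₂ (e , e″) | inj₁ e′
  with trans (cong suc (trans (sym (trans e′ (cong suc e))) (cong toℕ eq))) e″
... | ()
next²≢ (s≤s (s≤s (s≤s _))) i eq | inj₂ (e , _) | inj₂ (_ , e″) with trans (cong suc (sym e)) e″
... | ()

-- Sums and primitives over the field with two elements.

sum-false : ∀ {n} (t : Fin n → Bool) → (∀ i → t i ≡ false) → sum t ≡ false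
sum-false {n} t eq = trans (sum-cong-≗ eq) (sum-replicate-zero n)

sum-one : ∀ {n} (t : Fin n → Bool) a → (∀ i → i ≢ a → t i ≡ false) → sum t ≡ t a
sum-one t zero    eq =
  trans (cong (t zero xor_) (sum-false _ λ i → eq (suc i) λ ())) (xor-identityʳ _)
sum-one t (suc a) eq =
  cong₂ _xor_ (eq zero λ ()) (sum-one (t ∘ suc) a λ i i≢a → eq (suc i) (i≢a ∘ suc-injective))

sum-two : ∀ {n} (t : Fin n → Bool) a b → a ≢ b → (∀ i → i ≢ a → i ≢ b → t i ≡ false) →
          sum t ≡ t a xor t b
sum-two t zero    zero    a≢b eq = ⊥-elim (a≢b refl)
sum-two t zero    (suc b) a≢b eq =
  cong (t zero xor_) (sum-one (t ∘ suc) b λ i i≢b → eq (suc i) (λ ()) (i≢b ∘ suc-injective))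
sum-two t (suc a) zero    a≢b eq =
  trans (cong (t zero xor_) (sum-one (t ∘ suc) a λ i i≢a → eq (suc i) (i≢a ∘ suc-injective) (λ ())))
        (xor-comm (t zero) _)
sum-two t (suc a) (suc b) a≢b eq =
  cong₂ _xor_ (eq zero (λ ()) (λ ()))
    (sum-two (t ∘ suc) a b (a≢b ∘ cong suc)
      λ i i≢a i≢b → eq (suc i) (i≢a ∘ suc-injective) (i≢b ∘ suc-injective))

sum-next : ∀ {n} (t : Fin n → Bool) → sum (t ∘ next) ≡ sum t
sum-next {zero}  t = refl
sum-next {suc n} t = begin
  sum (t ∘ next)
    ≡⟨ sum-init-last (t ∘ next) ⟩
  sum (λ i → t (next (inject₁ i))) xor t (next (fromℕ n))
    ≡⟨ cong₂ _xor_ (sum-cong-≗ λ i → cong t (next-inject₁ i)) (cong t (next-fromℕ n)) ⟩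
  sum (t ∘ suc) xor t zero
    ≡⟨ xor-comm _ (t zero) ⟩
  sum t ∎
  where open ≡-Reasoning

partial-sum : ∀ {n} → (Fin n → Bool) → Fin n → Bool
partial-sum t zero    = false
partial-sum t (suc i) = t zero xor partial-sum (t ∘ suc) i

partial-sum-suc : ∀ {n} (t : Fin (suc n) → Bool) i →
                  partial-sum t (suc i) ≡ partial-sum t (inject₁ i) xor t (inject₁ i)
partial-sum-suc t zero    = xor-identityʳ _
partial-sum-suc t (suc i) = trans (cong (t zero xor_) (partial-sum-suc (t ∘ suc) i)) (sym (xor-assoc (t zero) _ _))

partial-sum-last : ∀ {n} (t : Fin (suc n) → Bool) →
                   sum t ≡ partial-sum t (fromℕ n) xor t (fromℕ n)
partial-sum-last {zero}  t = xor-identityʳ _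
partial-sum-last {suc n} t = trans (cong (t zero xor_) (partial-sum-last (t ∘ suc))) (sym (xor-assoc (t zero) _ _))

-- Partial sums are a primitive at every step but the wrap-around, and there the defect is the
-- total.
cyclic-primitive : ∀ {n} (t : Fin n → Bool) → sum t ≡ false →
                   ∀ j → partial-sum t (next j) ≡ partial-sum t j xor t j
cyclic-primitive {suc n} t ∑t≡0 j with view j
... | ‵fromℕ     = trans (cong (partial-sum t) (next-fromℕ n)) (sym (trans (sym (partial-sum-last t)) ∑t≡0))
... | ‵inject₁ i = trans (cong (partial-sum t) (next-inject₁ i)) (partial-sum-suc t i)

xor-cancel : ∀ {a b} → a xor b ≡ false → a ≡ b
xor-cancel {false} {false} _ = refl
xor-cancel {true}  {true}  _ = refl

xor-cancelˡ : ∀ a b → a xor (a xor b) ≡ b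
xor-cancelˡ false b = refl
xor-cancelˡ true  b = not-involutive b

xor-cancelʳ : ∀ a b → (a xor b) xor b ≡ a
xor-cancelʳ a b = trans (xor-comm (a xor b) b) (trans (cong (b xor_) (xor-comm a b)) (xor-cancelˡ b a))

xor-telescope : ∀ a b c → (a xor b) xor (b xor c) ≡ a xor c
xor-telescope a b c = trans (xor-assoc a b (b xor c)) (cong (a xor_) (xor-cancelˡ b c))

true≢false : true ≢ false
true≢false ()

≢⇒xor : ∀ {a b} → a ≢ b → a xor b ≡ true
≢⇒xor {false} {false} a≢b = ⊥-elim (a≢b refl)
≢⇒xor {false} {true}  _   = refl
≢⇒xor {true}  {false} _   = refl
≢⇒xor {true}  {true}  a≢b = ⊥-elim (a≢b refl)

≢false⇒true : ∀ {b} → b ≢ false → b ≡ true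
≢false⇒true {false} b≢0 = ⊥-elim (b≢0 refl)
≢false⇒true {true}  _   = refl

-- Linear algebra over the field with two elements.

_⊕_ : ∀ {n} → Vec Bool n → Vec Bool n → Vec Bool n
_⊕_ = zipWith _xor_

Additive : ∀ {n e} → (Vec Bool n → Fin e → Bool) → Set
Additive f = ∀ x y j → f (x ⊕ y) j ≡ f x j xor f y j

⊕-identityˡ : ∀ {n} (x : Vec Bool n) → Vec.replicate n false ⊕ x ≡ x
⊕-identityˡ []      = refl
⊕-identityˡ (b ∷ x) = cong (b ∷_) (⊕-identityˡ x)

-- The positions are the pivots of a column echelon form of f.
pivots : ∀ {n e} → Fin e → (f : Vec Bool n → Fin e → Bool) → Additive f →
         Σ (Fin n → Fin e) λ pos → (∀ x → (∀ i → f x (pos i) ≡ false) → ∀ j → f x j ≡ false)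
pivots {zero} {e} j₀ f add = (λ ()) , λ { [] _ j → trans (add [] [] j) (xor-same (f [] j)) }
pivots {suc n} {e} j₀ f add with all? (λ j → f (true ∷ Vec.replicate n false) j Bool.≟ false)
... | yes f₁≡0 = pos , vanish
  where
  ih = pivots j₀ (λ x → f (false ∷ x)) (λ x y → add (false ∷ x) (false ∷ y))
  pos : Fin (suc n) → Fin e
  -- The first generator maps to zero, so its pivot is a placeholder and constrains nothing.
  pos zero    = j₀
  pos (suc i) = proj₁ ih i
  drop : ∀ b x j → f (b ∷ x) j ≡ f (false ∷ x) j
  drop false x j = refl
  drop true  x j = begin
    f (true ∷ x) j                                            ≡⟨ cong (λ y → f (true ∷ y) j) (⊕-identityˡ x) ⟨
    f ((true ∷ Vec.replicate n false) ⊕ (false ∷ x)) j            ≡⟨ add (true ∷ Vec.replicate n false) (false ∷ x) j ⟩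
    f (true ∷ Vec.replicate n false) j xor f (false ∷ x) j        ≡⟨ cong (_xor f (false ∷ x) j) (f₁≡0 j) ⟩
    f (false ∷ x) j                                           ∎
    where open ≡-Reasoning
  vanish : ∀ x → (∀ i → f x (pos i) ≡ false) → ∀ j → f x j ≡ false
  vanish (b ∷ x) h j = trans (drop b x j) (proj₂ ih x (λ i → trans (sym (drop b x _)) (h (suc i))) j)
... | no ¬f₁≡0 with ¬∀⟶∃¬ e _ (λ j → f (true ∷ Vec.replicate n false) j Bool.≟ false) ¬f₁≡0
... | j₁ , f₁j₁≢0 = pos , vanish
  where
  open ≡-Reasoning
  one : f (true ∷ Vec.replicate n false) j₁ ≡ true
  one = ≢false⇒true f₁j₁≢0
  -- Elimination: `g` adds the first generator to a later combination exactly when this makes the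
  -- value at the pivot `j₁` vanish.
  at₁ : Vec Bool n → Bool
  at₁ x = f (false ∷ x) j₁
  g : Vec Bool n → Fin e → Bool
  g x = f (at₁ x ∷ x)
  g-add : Additive g
  g-add x y j = trans (cong (λ b → f (b ∷ (x ⊕ y)) j) (add (false ∷ x) (false ∷ y) j₁)) (add (at₁ x ∷ x) (at₁ y ∷ y) j)
  ih = pivots j₀ g g-add
  pos : Fin (suc n) → Fin e
  pos zero    = j₁
  pos (suc i) = proj₁ ih i
  at-pivot : ∀ b x → f (b ∷ x) j₁ ≡ b xor at₁ x
  at-pivot false x = refl
  at-pivot true  x = begin
    f (true ∷ x) j₁                                       ≡⟨ cong (λ y → f (true ∷ y) j₁) (⊕-identityˡ x) ⟨
    f ((true ∷ Vec.replicate n false) ⊕ (false ∷ x)) j₁       ≡⟨ add (true ∷ Vec.replicate n false) (false ∷ x) j₁ ⟩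
    f (true ∷ Vec.replicate n false) j₁ xor at₁ x             ≡⟨ cong (_xor at₁ x) one ⟩
    true xor at₁ x                                        ∎
  vanish : ∀ x → (∀ i → f x (pos i) ≡ false) → ∀ j → f x j ≡ false
  vanish (b ∷ x) h with xor-cancel {b} {at₁ x} (trans (sym (at-pivot b x)) (h zero))
  ... | refl = proj₂ ih x (λ i → h (suc i))

bit : Fin 2 → Bool
bit zero    = false
bit (suc _) = true

bit-injective : ∀ {x y} → bit x ≡ bit y → x ≡ y
bit-injective {zero}     {zero}     _ = refl
bit-injective {suc zero} {suc zero} _ = refl

unbit : Bool → Fin 2
unbit false = zero
unbit true  = suc zero

bit-unbit : ∀ b → bit (unbit b) ≡ b
bit-unbit false = refl
bit-unbit true  = refl

funToFin-cong : ∀ {m n} {f g : Fin m → Fin n} → (∀ i → f i ≡ g i) → funToFin f ≡ funToFin g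
funToFin-cong {zero}  eq = refl
funToFin-cong {suc m} eq = cong₂ combine (eq zero) (funToFin-cong (λ i → eq (suc i)))

-- The `2 ^ e` arguments have at most `2 ^ k` images, so two distinct ones collide; their difference
-- is the desired vector.
kernel-nonzero : ∀ {k e} → k < e → (f : (Fin e → Bool) → Fin k → Bool) →
                 (∀ x y i → f (λ j → x j xor y j) i ≡ f x i xor f y i) →
                 ∃[ x ] ((∀ i → f x i ≡ false) × ∃[ j ] x j ≡ true)
kernel-nonzero {k} {e} k<e f add
  with pigeonhole (^-monoʳ-< 2 (s≤s (s≤s z≤n)) k<e) (λ c → funToFin (λ i → unbit (f (vec c) i)))
  where
  vec : Fin (2 ^ e) → Fin e → Bool
  vec c j = bit (finToFun c j)
... | c , d , c<d , same = x , zero-image , nonzero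
  where
  vec : Fin (2 ^ e) → Fin e → Bool
  vec c j = bit (finToFun c j)
  x : Fin e → Bool
  x j = vec c j xor vec d j
  zero-image : ∀ i → f x i ≡ false
  zero-image i = trans (add (vec c) (vec d) i) (trans (cong (_xor f (vec d) i) agree) (xor-same (f (vec d) i)))
    where
    agree : f (vec c) i ≡ f (vec d) i
    agree = begin
      f (vec c) i                                                         ≡⟨ bit-unbit _ ⟨
      bit (unbit (f (vec c) i))                                           ≡⟨ cong bit (finToFun-funToFin _ i) ⟨
      bit (finToFun (funToFin (λ i → unbit (f (vec c) i))) i)             ≡⟨ cong (λ s → bit (finToFun s i)) same ⟩
      bit (finToFun (funToFin (λ i → unbit (f (vec d) i))) i)             ≡⟨ cong bit (finToFun-funToFin _ i) ⟩
      bit (unbit (f (vec d) i))                                           ≡⟨ bit-unbit _ ⟩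
      f (vec d) i                                                         ∎
      where open ≡-Reasoning
  nonzero : ∃[ j ] x j ≡ true
  nonzero with all? (λ j → finToFun c j ≟ finToFun d j)
  ... | yes eq = ⊥-elim (<⇒≢ c<d (cong toℕ
          (trans (sym (funToFin-finToFin {e} c)) (trans (funToFin-cong eq) (funToFin-finToFin {e} d)))))
  ... | no ¬eq with ¬∀⟶∃¬ e _ (λ j → finToFun c j ≟ finToFun d j) ¬eq
  ... | j , ne = j , ≢⇒xor (ne ∘ bit-injective)

-- Lists without repetition.

Unique-resp-↭ : ∀ {X : Set} {xs ys : List X} → xs ↭ ys → Unique xs → Unique ys
Unique-resp-↭ {X} xs↭ys = Permₛ.Unique-resp-↭ (setoid X) (↭⇒↭ₛ xs↭ys)

Unique-++⁻ : ∀ {X : Set} (xs : List X) {ys} → Unique (xs ++ ys) → Unique xs × Unique ys × Disjoint xs ys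
Unique-++⁻ []       u       = [] , u , λ ()
Unique-++⁻ (x ∷ xs) (x≢ ∷ u) with Unique-++⁻ xs u
... | ux , uy , disj = All.++⁻ˡ xs x≢ ∷ ux , uy , λ
  { (here refl , v∈ys) → All.lookup (All.++⁻ʳ xs x≢) v∈ys refl
  ; (there v∈xs , v∈ys) → disj (v∈xs , v∈ys) }

∈-reverse⁻ : ∀ {X : Set} {x : X} {xs} → x ∈ˡ reverse xs → x ∈ˡ xs
∈-reverse⁻ {xs = xs} = ∈-resp-↭ (↭-reverse xs)

∈-∈-∃++ : ∀ {X : Set} {u v : X} {xs} → u ∈ˡ xs → v ∈ˡ xs → u ≢ v →
          (∃[ ps ] ∃[ ms ] ∃[ ss ] xs ≡ ps ++ u ∷ ms ++ v ∷ ss) ⊎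
          (∃[ ps ] ∃[ ms ] ∃[ ss ] xs ≡ ps ++ v ∷ ms ++ u ∷ ss)
∈-∈-∃++ {u = u} {v} u∈ v∈ u≢v with ∈-∃++ u∈
... | ps , ss , refl with ∈-++⁻ ps v∈
...   | inj₂ (here v≡u) = ⊥-elim (u≢v (sym v≡u))
...   | inj₂ (there v∈ss) with ∈-∃++ v∈ss
...     | ms , ss′ , refl = inj₁ (ps , ms , ss′ , refl)
∈-∈-∃++ {u = u} {v} u∈ v∈ u≢v | ps , ss , refl | inj₁ v∈ps with ∈-∃++ v∈ps
... | ps′ , ms , refl = inj₂ (ps′ , ms , ss , ++-assoc ps′ (v ∷ ms) (u ∷ ss))

-- Ears and simple cycles in a graph with two mod 2 weights.

module SignedGraph {n : ℕ} (Adj : Fin n → Fin n → Set) (Adj? : ∀ u v → Dec (Adj u v))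
                   (Adj-sym : ∀ {u v} → Adj u v → Adj v u) (Adj-irrefl : ∀ {u} → ¬ Adj u u) where

  Node : Set
  Node = Fin n

  -- The list holds interior nodes only. A closed walk is therefore simple when `Unique (x ∷ as)`
  -- holds, with its base listed once.
  data Walk : Node → List Node → Node → Set where
    [_] : ∀ {x y} → Adj x y → Walk x [] y
    _∷_ : ∀ {x a as y} → Adj x a → Walk a as y → Walk x (a ∷ as) y

  Weight : Set
  Weight = Node → Node → Bool

  Symmetric : Weight → Set
  Symmetric ℓ = ∀ u v → ℓ u v ≡ ℓ v u

  weight : Weight → Node → List Node → Node → Bool
  weight ℓ x []       y = ℓ x y
  weight ℓ x (a ∷ as) y = ℓ x a xor weight ℓ a as y

  join : ∀ {x ps u ss y} → Walk x ps u → Walk u ss y → Walk x (ps ++ u ∷ ss) y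
  join [ e ]   w′ = e ∷ w′
  join (e ∷ w) w′ = e ∷ join w w′

  split : ∀ {x} ps {u ss y} → Walk x (ps ++ u ∷ ss) y → Walk x ps u × Walk u ss y
  split []       (e ∷ w) = [ e ] , w
  split (_ ∷ ps) (e ∷ w) = let w₁ , w₂ = split ps w in e ∷ w₁ , w₂

  reverse-walk : ∀ {x as y} → Walk x as y → Walk y (reverse as) x
  reverse-walk [ e ] = [ Adj-sym e ]
  reverse-walk {x} {a ∷ as} {y} (e ∷ w) =
    subst (λ bs → Walk y bs x) (sym (unfold-reverse a as)) (join (reverse-walk w) [ Adj-sym e ])

  weight-++ : ∀ ℓ x ps u ss y → weight ℓ x (ps ++ u ∷ ss) y ≡ weight ℓ x ps u xor weight ℓ u ss y
  weight-++ ℓ x []       u ss y = refl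
  weight-++ ℓ x (a ∷ ps) u ss y =
    trans (cong (ℓ x a xor_) (weight-++ ℓ a ps u ss y)) (sym (xor-assoc (ℓ x a) _ _))

  weight-reverse : ∀ {ℓ} → Symmetric ℓ → ∀ x as y → weight ℓ y (reverse as) x ≡ weight ℓ x as y
  weight-reverse {ℓ} ℓ-sym x []       y = ℓ-sym y x
  weight-reverse {ℓ} ℓ-sym x (a ∷ as) y = begin
    weight ℓ y (reverse (a ∷ as)) x            ≡⟨ cong (λ bs → weight ℓ y bs x) (unfold-reverse a as) ⟩
    weight ℓ y (reverse as ∷ʳ a) x             ≡⟨ weight-++ ℓ y (reverse as) a [] x ⟩
    weight ℓ y (reverse as) a xor ℓ a x        ≡⟨ cong₂ _xor_ (weight-reverse ℓ-sym a as y) (ℓ-sym a x) ⟩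
    weight ℓ a as y xor ℓ x a                  ≡⟨ xor-comm (weight ℓ a as y) _ ⟩
    ℓ x a xor weight ℓ a as y                  ∎
    where open ≡-Reasoning

  weight-false : ∀ x as y → weight (λ _ _ → false) x as y ≡ false
  weight-false x []       y = refl
  weight-false x (a ∷ as) y = weight-false a as y

  weight-combination : ∀ b ψ w x as y →
    weight (λ u v → ψ u v xor (b ∧ w u v)) x as y ≡ weight ψ x as y xor (b ∧ weight w x as y)
  weight-combination b ψ w x []       y = refl
  weight-combination b ψ w x (a ∷ as) y =
    trans (cong ((ψ x a xor (b ∧ w x a)) xor_) (weight-combination b ψ w a as y))
          (rearrange b (ψ x a) (w x a) (weight ψ a as y) (weight w a as y))
    where
    rearrange : ∀ b c d e f → (c xor (b ∧ d)) xor (e xor (b ∧ f)) ≡ (c xor e) xor (b ∧ (d xor f))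
    rearrange false c d e f =
      trans (cong₂ _xor_ (xor-identityʳ c) (xor-identityʳ e)) (sym (xor-identityʳ (c xor e)))
    rearrange true false d false f = refl
    rearrange true false false true f = refl
    rearrange true false true true f = refl
    rearrange true true false e f = not-distribˡ-xor e f
    rearrange true true true true f = refl
    rearrange true true true false f = sym (not-involutive f)

  weight-potential : ∀ {ℓ} (c : Node → Bool) → (∀ u v → Adj u v → ℓ u v ≡ c u xor c v) →
                     ∀ {x as y} → Walk x as y → weight ℓ x as y ≡ c x xor c y
  weight-potential c δ [ e ] = δ _ _ e
  weight-potential c δ {x} {a ∷ _} {y} (e ∷ w) =
    trans (cong₂ _xor_ (δ _ _ e) (weight-potential c δ w)) (xor-telescope (c x) (c a) (c y))

  record SimpleCycle (w ψ : Weight) (b : Bool) : Set where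
    field
      base     : Node
      interior : List Node
      walk     : Walk base interior base
      unique   : Unique (base ∷ interior)
      weight-w : weight w base interior base ≡ b
      weight-ψ : weight ψ base interior base ≡ true

  record Path (x y : Node) : Set where
    field
      nodes : List Node
      path-walk     : Walk x nodes y
      path-unique   : Unique (x ∷ y ∷ nodes)

  open Path

  reverse-path : ∀ {x y} → Path x y → Path y x
  reverse-path {x} {y} P = record
    { nodes = reverse (nodes P)
    ; path-walk     = reverse-walk (path-walk P)
    ; path-unique   = Unique-resp-↭ (↭-trans (swap x y ↭-refl) (prep y (prep x (↭-sym (↭-reverse _))))) (path-unique P) }

  append : ∀ {u x v ps} (P : Path u x) → Walk x ps v → Unique (v ∷ ps) →
           Disjoint (u ∷ x ∷ nodes P) (v ∷ ps) → Path u v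
  append {u} {x} {v} {ps} P W vps disj = record
    { nodes = nodes P ++ x ∷ ps
    ; path-walk     = join (path-walk P) W
    ; path-unique   = Unique-resp-↭ (prep u
        (↭-trans (Perm.shift v (x ∷ nodes P) ps) (prep v (↭-sym (Perm.shift x (nodes P) ps)))))
        (++⁺ (path-unique P) vps disj) }

  -- The potential which agrees with c off the list as and makes ℓ vanish along the walk x, as.
  extend : Weight → Node → List Node → Bool → (Node → Bool) → Node → Bool
  extend ℓ x []       b c z = c z
  extend ℓ x (a ∷ as) b c z with z ≟ a
  ... | yes _ = b xor ℓ x a
  ... | no  _ = extend ℓ a as (b xor ℓ x a) c z

  extend-∉ : ∀ ℓ x as b c {z} → z ∉ˡ as → extend ℓ x as b c z ≡ c z
  extend-∉ ℓ x []       b c z∉ = refl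
  extend-∉ ℓ x (a ∷ as) b c {z} z∉ with z ≟ a
  ... | yes z≡a = ⊥-elim (z∉ (here z≡a))
  ... | no  _   = extend-∉ ℓ a as (b xor ℓ x a) c (z∉ ∘ there)

  extend-∈ : ∀ ℓ x ps b c {z} ss → z ∉ˡ ps →
             extend ℓ x (ps ++ z ∷ ss) b c z ≡ b xor weight ℓ x ps z
  extend-∈ ℓ x [] b c {z} ss z∉ with z ≟ z
  ... | yes _  = refl
  ... | no z≢z = ⊥-elim (z≢z refl)
  extend-∈ ℓ x (a ∷ ps) b c {z} ss z∉ with z ≟ a
  ... | yes z≡a = ⊥-elim (z∉ (here z≡a))
  ... | no  _   = trans (extend-∈ ℓ a ps (b xor ℓ x a) c ss (z∉ ∘ there)) (xor-assoc b _ _)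

  insert : List Node → Subset n → Subset n
  insert as S = foldr (λ a T → ⁅ a ⁆ ∪ T) S as

  insert-⊇ : ∀ as {S z} → z ∈ S → z ∈ insert as S
  insert-⊇ []       z∈S = z∈S
  insert-⊇ (a ∷ as) z∈S = x∈p∪q⁺ (inj₂ (insert-⊇ as z∈S))

  insert-∈ : ∀ {as S z} → z ∈ˡ as → z ∈ insert as S
  insert-∈ (here refl)  = x∈p∪q⁺ (inj₁ (x∈⁅x⁆ _))
  insert-∈ (there z∈as) = x∈p∪q⁺ (inj₂ (insert-∈ z∈as))

  insert-⁻ : ∀ as {S z} → z ∈ insert as S → z ∈ˡ as ⊎ z ∈ S
  insert-⁻ []       z∈ = inj₂ z∈
  insert-⁻ (a ∷ as) z∈ with x∈p∪q⁻ ⁅ a ⁆ _ z∈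
  ... | inj₁ z∈a = inj₁ (here (x∈⁅y⁆⇒x≡y a z∈a))
  ... | inj₂ z∈′ with insert-⁻ as z∈′
  ...   | inj₁ z∈as = inj₁ (there z∈as)
  ...   | inj₂ z∈S  = inj₂ z∈S

  -- `between` may be empty: chords are ears too, and the last step of the search needs them.
  record Ear (S : Subset n) : Set where
    field
      start end : Node
      between   : List Node
      ear-walk  : Walk start between end
      start∈    : start ∈ S
      end∈      : end ∈ S
      start≢end : start ≢ end
      distinct  : Unique between
      outside   : All (_∉ S) between

  first-hit : ∀ S {a as y} → Walk a as y → y ∈ S →
              ∃[ ps ] ∃[ z ] ∃[ ss ] (Walk a ps z × z ∈ S × All (_∉ S) ps × as ∷ʳ y ≡ ps ++ z ∷ ss)
  first-hit S [ e ] y∈S = [] , _ , [] , [ e ] , y∈S , [] , refl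
  first-hit S {as = b ∷ as} (e ∷ w) y∈S with b ∈? S
  ... | yes b∈S = [] , b , _ , [ e ] , b∈S , [] , refl
  ... | no  b∉S with first-hit S w y∈S
  ...   | ps , z , ss , w′ , z∈S , out , eq = b ∷ ps , z , ss , e ∷ w′ , z∈S , b∉S ∷ out , cong (b ∷_) eq

  -- Skip nodes as long as they stay in `S`. The first one outside opens the ear, the next return to
  -- `S` closes it, and simplicity of the walk keeps the two ends distinct.
  walk-ear : ∀ S {x as y} → Walk x as y → x ∈ S → y ∈ S → Unique (x ∷ as ∷ʳ y) → Any (_∉ S) as →
             Σ (Ear S) λ E → ∃₂ λ a bs → Ear.between E ≡ a ∷ bs
  walk-ear S {x} {a ∷ as} (e ∷ w) x∈S y∈S (x≢ ∷ u) out with a ∈? S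
  walk-ear S {x} {a ∷ as} (e ∷ w) x∈S y∈S (x≢ ∷ u) (here a∉S)  | yes a∈S = ⊥-elim (a∉S a∈S)
  walk-ear S {x} {a ∷ as} (e ∷ w) x∈S y∈S (x≢ ∷ u) (there out) | yes a∈S = walk-ear S w a∈S y∈S u out
  walk-ear S {x} {a ∷ as} (e ∷ w) x∈S y∈S (x≢ ∷ u) _           | no  a∉S with first-hit S w y∈S
  ... | ps , z , ss , w′ , z∈S , out , eq =
    record
      { start = x ; end = z ; between = a ∷ ps ; ear-walk = e ∷ w′ ; start∈ = x∈S ; end∈ = z∈S
      ; start≢end = λ x≡z → All.lookup x≢ z∈ x≡z
      ; distinct = proj₁ (Unique-++⁻ (a ∷ ps) (subst Unique (cong (a ∷_) eq) u))
      ; outside = a∉S ∷ out }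
    , a , ps , refl
    where
    z∈ : z ∈ˡ a ∷ as ∷ʳ _
    z∈ = there (subst (z ∈ˡ_) (sym eq) (∈-++⁺ʳ ps (here refl)))

  Potential : Weight → Set
  Potential ψ = Σ (Node → Bool) λ c → (∀ u v → Adj u v → ψ u v ≡ c u xor c v)

  -- The form in which 2-connectedness enters. The ear must have an interior node so that attaching
  -- it enlarges `S` and the search terminates.
  Supply : Set
  Supply = ∀ S {u v} → u ∈ S → v ∈ S → Adj u v →
           (∀ z → z ∈ S) ⊎ Σ (Ear S) λ E → ∃₂ λ a bs → Ear.between E ≡ a ∷ bs

  -- `T` is the set of signs that joining paths are asked to realise; it lets two searches share one
  -- proof. With the zero weight it contains only `false` and the start is an edge; with a genuine
  -- signing it contains both signs and the start is a cycle. Closure is required because prolonging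
  -- a path along part of an ear changes its sign by the weight of that part.
  module Growth (w ψ : Weight) (w-sym : Symmetric w) (ψ-sym : Symmetric ψ)
                (T : Bool → Set) (T-false : T false)
                (T-closed : ∀ {b} → T b → ∀ x as y → T (b xor weight w x as y)) where

    record Connects (S : Subset n) (c : Node → Bool) (x y : Node) (b : Bool) : Set where
      constructor via
      field
        path   : Path x y
        inside : All (_∈ S) (nodes path)
        sign   : weight w x (nodes path) y ≡ b
        gauge  : weight ψ x (nodes path) y ≡ c x xor c y

    open Connects

    -- In the gauge given by the potential c, ψ is invisible on S but every sign in T
    -- is realised between any two nodes.
    Joined : Subset n → (Node → Bool) → Set
    Joined S c = ∀ x y → x ∈ S → y ∈ S → x ≢ y → ∀ b → T b → Connects S c x y b

    Connects-sym : ∀ {S c x y b} → Connects S c x y b → Connects S c y x b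
    Connects-sym {S} {c} {x} {y} (via P inS eqw eqψ) = via
      (reverse-path P) (All-resp-↭ (↭-sym (↭-reverse _)) inS)
      (trans (weight-reverse w-sym x (nodes P) y) eqw)
      (trans (weight-reverse ψ-sym x (nodes P) y) (trans eqψ (xor-comm (c x) (c y))))

    Connects-append : ∀ {S c u x v ps b} (C : Connects S c u x b) → Walk x ps v → Unique (v ∷ ps) →
                      Disjoint (u ∷ x ∷ nodes (path C)) (v ∷ ps) → x ∈ S → All (_∈ S) ps →
                      weight ψ x ps v ≡ c x xor c v → Connects S c u v (b xor weight w x ps v)
    Connects-append {S} {c} {u} {x} {v} {ps} (via P inS eqw eqψ) W vps disj x∈S ps∈S eq = via
      (append P W vps disj) (All.++⁺ inS (x∈S ∷ ps∈S))
      (trans (weight-++ w u (nodes P) x ps v) (cong (_xor weight w x ps v) eqw))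
      (trans (weight-++ ψ u (nodes P) x ps v) (trans (cong₂ _xor_ eqψ eq) (xor-telescope (c u) (c x) (c v))))

    weaken : ∀ {S S′ c x y b} → S ⊆ S′ → Connects S c x y b → Connects S′ c x y b
    weaken S⊆S′ (via P inS eqw eqψ) = via P (All.map S⊆S′ inS) eqw eqψ

    -- The path inside `R` is asked for the sign corrected by the weight of the new piece, which
    -- then restores `b`. The new nodes avoid `R`, so the concatenation is simple.
    attach : ∀ {R c u x v ps b} → Connects R c u x (b xor weight w x ps v) → Walk x ps v → Unique (v ∷ ps) →
             All (_∉ R) (v ∷ ps) → u ∈ R → x ∈ R → weight ψ x ps v ≡ c x xor c v →
             Connects (insert (v ∷ ps) R) c u v b
    attach {R} {c} {u} {x} {v} {ps} {b} C W vps out u∈R x∈R eq =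
      subst (Connects _ c u v) (xor-cancelʳ b (weight w x ps v))
        (Connects-append (weaken (insert-⊇ (v ∷ ps)) C) W vps disj (insert-⊇ (v ∷ ps) x∈R)
          (All.tabulate λ z∈ → insert-∈ (there z∈)) eq)
      where
      disj : Disjoint (u ∷ x ∷ nodes (path C)) (v ∷ ps)
      disj (here refl , z∈)         = All.lookup out z∈ u∈R
      disj (there (here refl) , z∈) = All.lookup out z∈ x∈R
      disj (there (there z∈C) , z∈) = All.lookup out z∈ (All.lookup (inside C) z∈C)

    -- The return path is chosen with the same twist as the ear, so the twists cancel. Its ψ is a
    -- potential difference, so ψ of the whole cycle is the amount by which the ear violates the
    -- potential.
    close-ear : ∀ {S c} → Joined S c → (E : Ear S) → let open Ear E in
                weight ψ start between end ≢ c start xor c end → SimpleCycle w ψ false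
    close-ear {S} {c} J E mismatch
      with J end start end∈ start∈ (start≢end ∘ sym) (weight w start between end)
             (T-closed T-false start between end)
      where open Ear E
    ... | via P inS eqw eqψ = record
      { base     = start
      ; interior = between ++ end ∷ nodes P
      ; walk     = join ear-walk (path-walk P)
      ; unique   = Unique-resp-↭
          (↭-trans (swap end start ↭-refl) (prep start (Perm.++-comm (end ∷ nodes P) between)))
          (++⁺ (path-unique P) distinct disj)
      ; weight-w = trans (weight-++ w start between end _ start)
          (trans (cong (weight w start between end xor_) eqw) (xor-same (weight w start between end)))
      ; weight-ψ = trans (weight-++ ψ start between end _ start)
          (trans (cong (weight ψ start between end xor_) (trans eqψ (xor-comm (c end) (c start)))) (≢⇒xor mismatch)) }
      where
      open Ear E
      disj : Disjoint (end ∷ start ∷ nodes P) between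
      disj (here refl , z∈)         = All.lookup outside z∈ end∈
      disj (there (here refl) , z∈) = All.lookup outside z∈ start∈
      disj (there (there z∈P) , z∈) = All.lookup outside z∈ (All.lookup inS z∈P)

    -- An old node reaches a new one by entering the ear through `start`; `start` itself goes to
    -- `end` and enters backwards. Two new nodes leave the ear at its two ends and are joined across
    -- `S`. Every such path contains an old stretch with distinct ends, where all signs of `T` are
    -- available.
    add-ear : ∀ {S c} → Joined S c → (E : Ear S) → let open Ear E in
              weight ψ start between end ≡ c start xor c end →
              Joined (insert between S) (extend ψ start between (c start) c)
    add-ear {S} {c} J E match = joined
      where
      open Ear E
      S′ = insert between S
      c′ = extend ψ start between (c start) c

      c′-S : ∀ {z} → z ∈ S → c′ z ≡ c z
      c′-S z∈S = extend-∉ ψ start between (c start) c λ z∈ → All.lookup outside z∈ z∈S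

      old : ∀ {x y} → x ∈ S → y ∈ S → x ≢ y → ∀ b → T b → Connects S c′ x y b
      old x∈ y∈ x≢y b Tb with J _ _ x∈ y∈ x≢y b Tb
      ... | via P inS eqw eqψ = via P inS eqw (trans eqψ (sym (cong₂ _xor_ (c′-S x∈) (c′-S y∈))))

      module At {ps v ss} (eq : between ≡ ps ++ v ∷ ss) where
        walks = split ps (subst (λ as → Walk start as end) eq ear-walk)
        walk-pre : Walk start ps v
        walk-pre = proj₁ walks
        walk-suf : Walk end (reverse ss) v
        walk-suf = reverse-walk (proj₂ walks)

        uniques : Unique ps × Unique (v ∷ ss) × Disjoint ps (v ∷ ss)
        uniques = Unique-++⁻ ps (subst Unique eq distinct)
        v∉ps : v ∉ˡ ps
        v∉ps v∈ = proj₂ (proj₂ uniques) (v∈ , here refl)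
        unique-pre : Unique (v ∷ ps)
        unique-pre = All.tabulate (λ { z∈ refl → v∉ps z∈ }) ∷ proj₁ uniques
        unique-suf : Unique (v ∷ reverse ss)
        unique-suf = Unique-resp-↭ (prep v (↭-sym (↭-reverse ss))) (proj₁ (proj₂ uniques))

        outs : All (_∉ S) ps × All (_∉ S) (v ∷ ss)
        outs = let o = subst (All (_∉ S)) eq outside in All.++⁻ˡ ps o , All.++⁻ʳ ps o
        out-pre : All (_∉ S) (v ∷ ps)
        out-pre = All.head (proj₂ outs) ∷ proj₁ outs
        out-suf : All (_∉ S) (v ∷ reverse ss)
        out-suf = All-resp-↭ (prep v (↭-sym (↭-reverse ss))) (proj₂ outs)

        c′-v : c′ v ≡ c start xor weight ψ start ps v
        c′-v = trans (cong (λ as → extend ψ start as (c start) c v) eq) (extend-∈ ψ start ps (c start) c ss v∉ps)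
        weight-pre : weight ψ start ps v ≡ c′ start xor c′ v
        weight-pre = sym (trans (cong₂ _xor_ (c′-S start∈) c′-v) (xor-cancelˡ (c start) _))
        -- Here `match` enters: the potential, defined by walking from `start`, is also correct when
        -- the ear is walked from `end`.
        weight-suf : weight ψ end (reverse ss) v ≡ c′ end xor c′ v
        weight-suf = trans (weight-reverse ψ-sym v ss end)
          (trans (solve-end (c start) (c end) (weight ψ start ps v) (weight ψ v ss end)
                    (trans (sym (weight-++ ψ start ps v ss end))
                           (trans (cong (λ as → weight ψ start as end) (sym eq)) match)))
                 (sym (cong₂ _xor_ (c′-S end∈) c′-v)))
          where
          solve-end : ∀ s e a d → a xor d ≡ s xor e → d ≡ e xor (s xor a)
          solve-end false e     false d h = trans h (sym (xor-identityʳ e))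
          solve-end false false true  d h = trans (sym (not-involutive d)) (cong not h)
          solve-end false true  true  d h = trans (sym (not-involutive d)) (cong not h)
          solve-end true  false false d h = h
          solve-end true  true  false d h = h
          solve-end true  e     true  d h = trans (sym (not-involutive d))
            (trans (cong not h) (trans (not-involutive e) (sym (xor-identityʳ e))))

        ⊆-pre : insert (v ∷ ps) S ⊆ S′
        ⊆-pre z∈ with insert-⁻ (v ∷ ps) z∈
        ... | inj₂ z∈S          = insert-⊇ between z∈S
        ... | inj₁ (here refl)  = insert-∈ (subst (v ∈ˡ_) (sym eq) (∈-++⁺ʳ ps (here refl)))
        ... | inj₁ (there z∈ps) = insert-∈ (subst (_ ∈ˡ_) (sym eq) (∈-++⁺ˡ z∈ps))
        ⊆-suf : insert (v ∷ reverse ss) S ⊆ S′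
        ⊆-suf z∈ with insert-⁻ (v ∷ reverse ss) z∈
        ... | inj₂ z∈S          = insert-⊇ between z∈S
        ... | inj₁ (here refl)  = insert-∈ (subst (v ∈ˡ_) (sym eq) (∈-++⁺ʳ ps (here refl)))
        ... | inj₁ (there z∈ss) =
          insert-∈ (subst (_ ∈ˡ_) (sym eq) (∈-++⁺ʳ ps (there (∈-reverse⁻ {xs = ss} z∈ss))))

        via-start : ∀ {u} → u ∈ S → u ≢ start → ∀ b → T b → Connects (insert (v ∷ ps) S) c′ u v b
        via-start u∈ u≢ b Tb = attach (old u∈ start∈ u≢ _ (T-closed Tb start ps v))
          walk-pre unique-pre out-pre u∈ start∈ weight-pre
        via-end : ∀ {u} → u ∈ S → u ≢ end → ∀ b → T b → Connects (insert (v ∷ reverse ss) S) c′ u v b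
        via-end u∈ u≢ b Tb = attach (old u∈ end∈ u≢ _ (T-closed Tb end (reverse ss) v))
          walk-suf unique-suf out-suf u∈ end∈ weight-suf

      old-new : ∀ {u v} → u ∈ S → v ∈ˡ between → ∀ b → T b → Connects S′ c′ u v b
      old-new {u} u∈ v∈ b Tb with ∈-∃++ v∈ | u ≟ start
      ... | ps , ss , eq | no  u≢start = weaken (At.⊆-pre {ps} eq) (At.via-start {ps} eq u∈ u≢start b Tb)
      ... | ps , ss , eq | yes refl    = weaken (At.⊆-suf {ps} eq) (At.via-end {ps} eq u∈ start≢end b Tb)

      new-new : ∀ {u v ps ms ss} → between ≡ ps ++ u ∷ ms ++ v ∷ ss → ∀ b → T b → Connects S′ c′ v u b
      new-new {u} {v} {ps} {ms} {ss} eq b Tb =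
        weaken ⊆S′
          (attach (Connects-sym (At-v.via-end start∈ start≢end _ (T-closed Tb start ps u)))
            At-u.walk-pre At-u.unique-pre out (insert-∈ {as = v ∷ reverse ss} (here refl))
            (insert-⊇ (v ∷ reverse ss) start∈) At-u.weight-pre)
        where
        module At-u = At {ps} {u} {ms ++ v ∷ ss} eq
        module At-v = At {ps ++ u ∷ ms} {v} {ss} (trans eq (sym (++-assoc ps (u ∷ ms) (v ∷ ss))))
        R = insert (v ∷ reverse ss) S
        before : ∀ {z} → z ∈ˡ u ∷ ps → z ∈ˡ ps ++ u ∷ ms
        before (here refl) = ∈-++⁺ʳ ps (here refl)
        before (there z∈)  = ∈-++⁺ˡ z∈
        out : All (_∉ R) (u ∷ ps)
        out = All.tabulate λ {z} z∈ z∈R → clash z∈ (insert-⁻ (v ∷ reverse ss) z∈R)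
          where
          clash : ∀ {z} → z ∈ˡ u ∷ ps → ¬ (z ∈ˡ v ∷ reverse ss ⊎ z ∈ S)
          clash z∈ (inj₂ z∈S)          = All.lookup At-u.out-pre z∈ z∈S
          clash z∈ (inj₁ (here refl))  = proj₂ (proj₂ At-v.uniques) (before z∈ , here refl)
          clash z∈ (inj₁ (there z∈ss)) = proj₂ (proj₂ At-v.uniques) (before z∈ , there (∈-reverse⁻ {xs = ss} z∈ss))
        ⊆S′ : insert (u ∷ ps) R ⊆ S′
        ⊆S′ z∈ with insert-⁻ (u ∷ ps) z∈
        ... | inj₁ z∈ps = At-u.⊆-pre (insert-∈ z∈ps)
        ... | inj₂ z∈R  = At-v.⊆-suf z∈R

      joined : Joined S′ c′
      joined x y x∈ y∈ x≢y b Tb with insert-⁻ between x∈ | insert-⁻ between y∈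
      ... | inj₂ x∈S | inj₂ y∈S = weaken (insert-⊇ between) (old x∈S y∈S x≢y b Tb)
      ... | inj₂ x∈S | inj₁ y∈E = old-new x∈S y∈E b Tb
      ... | inj₁ x∈E | inj₂ y∈S = Connects-sym (old-new y∈S x∈E b Tb)
      ... | inj₁ x∈E | inj₁ y∈E with ∈-∈-∃++ x∈E y∈E x≢y
      ...   | inj₁ (ps , ms , ss , eq) = Connects-sym (new-new {ps = ps} {ms} {ss} eq b Tb)
      ...   | inj₂ (ps , ms , ss , eq) = new-new {ps = ps} {ms} {ss} eq b Tb

    grow : Supply → ∀ S c {u v} → u ∈ S → v ∈ S → Adj u v → Joined S c → Acc _⊃_ S →
           SimpleCycle w ψ false ⊎ Potential ψ
    grow supply S c u∈ v∈ uv J (acc rec) with supply S u∈ v∈ uv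
    ... | inj₂ (E , a , bs , between≡) with weight ψ start between end Bool.≟ c start xor c end
      where open Ear E
    ...   | no  mismatch = inj₁ (close-ear J E mismatch)
    ...   | yes match    =
      grow supply (insert between S) _ (insert-⊇ between u∈) (insert-⊇ between v∈) uv (add-ear J E match)
        (rec (insert-⊇ between , a , insert-∈ a∈ , All.lookup outside a∈))
      where
      open Ear E
      a∈ : a ∈ˡ between
      a∈ = subst (a ∈ˡ_) (sym between≡) (here refl)
    -- All nodes are joined, but an edge that no ear has used may still violate the potential; such
    -- an edge is an ear with empty interior.
    grow supply S c u∈ v∈ uv J (acc rec) | inj₁ full
      with all? (λ x → all? λ y → Adj? x y →-dec (ψ x y Bool.≟ c x xor c y))
    ... | yes potential = inj₂ (c , potential)
    ... | no ¬potential with ¬∀⟶∃¬ n _ (λ x → all? λ y → Adj? x y →-dec (ψ x y Bool.≟ c x xor c y)) ¬potential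
    ...   | x , ¬x with ¬∀⟶∃¬ n _ (λ y → Adj? x y →-dec (ψ x y Bool.≟ c x xor c y)) ¬x
    ...     | y , ¬xy with Adj? x y
    ...       | no ¬adj = ⊥-elim (¬xy (⊥-elim ∘ ¬adj))
    ...       | yes adj = inj₁ (close-ear J ear (λ eq → ¬xy (λ _ → eq)))
      where
      ear : Ear S
      ear = record { start = x ; end = y ; between = [] ; ear-walk = [ adj ] ; start∈ = full x ; end∈ = full y
                   ; start≢end = λ { refl → Adj-irrefl adj } ; distinct = [] ; outside = [] }

  zero-weight : Weight
  zero-weight _ _ = false

  -- The unsigned search: every sign is `false`, so a single edge already joins its ends in all
  -- required ways. It is run on `twist` and, when that has a potential, on ψ.
  grow-from-edge : Supply → ∀ {ψ} → Symmetric ψ → ∀ {x y} → Adj x y →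
                   SimpleCycle zero-weight ψ false ⊎ Potential ψ
  grow-from-edge supply {ψ} ψ-sym {x} {y} xy =
    grow supply S c (insert-∈ {as = x ∷ y ∷ []} (here refl)) (insert-∈ {as = x ∷ y ∷ []} (there (here refl)))
         xy joined (⊃-wellFounded S)
    where
    stays-false : ∀ {b} → b ≡ false → ∀ x as y → b xor weight zero-weight x as y ≡ false
    stays-false refl x as y = weight-false x as y
    open Growth zero-weight ψ (λ _ _ → refl) ψ-sym (_≡ false) refl stays-false
    S = insert (x ∷ y ∷ []) ∅
    c = extend ψ x (y ∷ []) false (λ _ → false)
    x≢y : x ≢ y
    x≢y refl = Adj-irrefl xy
    c-x : c x ≡ false
    c-x = extend-∉ ψ x (y ∷ []) false _ λ { (here x≡y) → x≢y x≡y }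
    c-y : c y ≡ ψ x y
    c-y = extend-∈ ψ x [] false (λ _ → false) [] λ ()
    edge : ∀ b → b ≡ false → Connects S c x y b
    edge b b≡0 = via (record { nodes = [] ; path-walk = [ xy ] ; path-unique = (x≢y ∷ []) ∷ [] ∷ [] }) []
      (sym b≡0) (sym (cong₂ _xor_ c-x c-y))
    ends : ∀ {z} → z ∈ S → z ≡ x ⊎ z ≡ y
    ends z∈ with insert-⁻ (x ∷ y ∷ []) z∈
    ... | inj₁ (here z≡x)         = inj₁ z≡x
    ... | inj₁ (there (here z≡y)) = inj₂ z≡y
    ... | inj₂ z∈∅                = ⊥-elim (∉⊥ z∈∅)
    joined : Joined S c
    joined u v u∈ v∈ u≢v b b≡0 with ends u∈ | ends v∈
    ... | inj₁ refl | inj₁ refl = ⊥-elim (u≢v refl)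
    ... | inj₁ refl | inj₂ refl = edge b b≡0
    ... | inj₂ refl | inj₁ refl = Connects-sym (edge b b≡0)
    ... | inj₂ refl | inj₂ refl = ⊥-elim (u≢v refl)

  -- The two arcs between two nodes of the cycle have opposite twist, as the cycle is odd for `w`,
  -- and the same ψ, as it is even for ψ. So both signs are realised in one gauge.
  grow-from-cycle : Supply → ∀ {w ψ} → Symmetric w → Symmetric ψ → ∀ {x as} → Walk x as x → Unique (x ∷ as) →
                    weight w x as x ≡ true → weight ψ x as x ≡ false →
                    SimpleCycle w ψ false ⊎ Potential ψ
  grow-from-cycle supply w-sym ψ-sym {as = []}    [ e ]       _ _ _ = ⊥-elim (Adj-irrefl e)
  grow-from-cycle supply {w} {ψ} w-sym ψ-sym {x} {as@(a ∷ _)} closed@(xa ∷ _) uniq odd even =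
    grow supply S c (insert-∈ {as = x ∷ as} (here refl)) (insert-∈ {as = x ∷ as} (there (here refl)))
         xa joined (⊃-wellFounded S)
    where
    open Growth w ψ w-sym ψ-sym (λ _ → ⊤) tt (λ _ _ _ _ → tt)
    S = insert (x ∷ as) ∅
    c = extend ψ x as false (λ _ → false)
    c-x : c x ≡ false
    c-x = extend-∉ ψ x as false _ (Unique[x∷xs]⇒x∉xs uniq)

    module At {ps v ss} (eq : as ≡ ps ++ v ∷ ss) where
      walks = split ps (subst (λ as → Walk x as x) eq closed)
      uniques : Unique ps × Unique (v ∷ ss) × Disjoint ps (v ∷ ss)
      uniques = Unique-++⁻ ps (subst Unique eq (AllPairs.tail uniq))
      x≢as : All (x ≢_) ps × All (x ≢_) (v ∷ ss)
      x≢as = let x≢ = subst (All (x ≢_)) eq (AllPairs.head uniq) in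
             All.++⁻ˡ ps x≢ , All.++⁻ʳ ps x≢
      v∉ps : v ∉ˡ ps
      v∉ps v∈ = proj₂ (proj₂ uniques) (v∈ , here refl)
      unique-pre : Unique (v ∷ ps)
      unique-pre = All.tabulate (λ { z∈ refl → v∉ps z∈ }) ∷ proj₁ uniques
      c-v : c v ≡ weight ψ x ps v
      c-v = trans (cong (λ as → extend ψ x as false (λ _ → false) v) eq) (extend-∈ ψ x ps false _ ss v∉ps)
      weight-pre : weight ψ x ps v ≡ c x xor c v
      weight-pre = sym (cong₂ _xor_ c-x c-v)

      along : Connects (insert (x ∷ v ∷ ps) ∅) c x v (weight w x ps v)
      along = via
        (record { nodes = ps ; path-walk = proj₁ walks
                ; path-unique = (All.head (proj₂ x≢as) ∷ proj₁ x≢as) ∷ unique-pre })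
        (All.tabulate λ z∈ → insert-∈ (there (there z∈))) refl weight-pre

      against : Connects (insert (x ∷ v ∷ ss) ∅) c x v (not (weight w x ps v))
      against = Connects-sym (via
        (record { nodes = ss ; path-walk = proj₂ walks
                ; path-unique = Unique-resp-↭ (↭-trans (prep x ↭-refl) (swap x v ↭-refl))
                    (proj₂ x≢as ∷ proj₁ (proj₂ uniques)) })
        (All.tabulate λ z∈ → insert-∈ (there (there z∈)))
        (complement (weight w x ps v) _ (total w odd))
        (trans (sym (xor-cancel (total ψ even))) (trans weight-pre (xor-comm (c x) (c v)))))
        where
        total : ∀ ℓ {b} → weight ℓ x as x ≡ b → weight ℓ x ps v xor weight ℓ v ss x ≡ b
        total ℓ eq′ = trans (sym (weight-++ ℓ x ps v ss x)) (trans (cong (λ as → weight ℓ x as x) (sym eq)) eq′)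
        complement : ∀ a b → a xor b ≡ true → b ≡ not a
        complement false b h = h
        complement true  b h = trans (sym (not-involutive b)) (cong not h)

      arc⊆S : ∀ {zs} → (∀ {z} → z ∈ˡ zs → z ∈ˡ as) → insert (x ∷ zs) ∅ ⊆ S
      arc⊆S {zs} zs⊆as z∈ with insert-⁻ (x ∷ zs) z∈
      ... | inj₁ (here refl) = insert-∈ {as = x ∷ as} (here refl)
      ... | inj₁ (there z∈zs) = insert-∈ {as = x ∷ as} (there (zs⊆as z∈zs))
      ... | inj₂ z∈∅         = ⊥-elim (∉⊥ z∈∅)

      pre⊆ : ∀ {z} → z ∈ˡ v ∷ ps → z ∈ˡ as
      pre⊆ (here refl) = subst (v ∈ˡ_) (sym eq) (∈-++⁺ʳ ps (here refl))
      pre⊆ (there z∈)  = subst (_ ∈ˡ_) (sym eq) (∈-++⁺ˡ z∈)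
      suf⊆ : ∀ {z} → z ∈ˡ v ∷ ss → z ∈ˡ as
      suf⊆ z∈ = subst (_ ∈ˡ_) (sym eq) (∈-++⁺ʳ ps z∈)

    either : ∀ {u v d} → Connects S c u v d → Connects S c u v (not d) → ∀ b → Connects S c u v b
    either {d = false} C C′ false = C
    either {d = false} C C′ true  = C′
    either {d = true}  C C′ false = C′
    either {d = true}  C C′ true  = C

    from-base : ∀ {v} → v ∈ˡ as → ∀ b → Connects S c x v b
    from-base v∈ with ∈-∃++ v∈
    ... | ps , ss , eq = either (weaken (arc⊆S pre⊆) along) (weaken (arc⊆S suf⊆) against)
      where open At {ps} eq

    off-base : ∀ {u v ps ms ss} → as ≡ ps ++ u ∷ ms ++ v ∷ ss → ∀ b → Connects S c v u b
    off-base {u} {v} {ps} {ms} {ss} eq = either direct around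
      where
      eq′ : as ≡ (ps ++ u ∷ ms) ++ v ∷ ss
      eq′ = trans eq (sym (++-assoc ps (u ∷ ms) (v ∷ ss)))
      module At-u = At {ps} {u} {ms ++ v ∷ ss} eq
      module At-v = At {ps ++ u ∷ ms} {v} {ss} eq′
      R = insert (x ∷ v ∷ ss) ∅

      mid : Walk u ms v
      mid = proj₁ (split ms (proj₂ At-u.walks))
      unique-mid : Unique (v ∷ u ∷ ms)
      unique-mid = All.tabulate (λ { z∈ refl → At-v.v∉ps (∈-++⁺ʳ ps z∈) }) ∷
                   proj₁ (proj₂ (Unique-++⁻ ps (proj₁ At-v.uniques)))
      weight-mid : weight ψ u ms v ≡ c u xor c v
      weight-mid = sym (trans (cong₂ _xor_ At-u.c-v (trans At-v.c-v (weight-++ ψ x ps u ms v)))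
                              (xor-cancelˡ (weight ψ x ps u) _))

      direct : Connects S c v u (weight w u ms v)
      direct = Connects-sym (via
        (record { nodes = ms ; path-walk = mid ; path-unique = Unique-resp-↭ (swap v u ↭-refl) unique-mid })
        (All.tabulate λ z∈ → insert-∈ {as = x ∷ as} (there (At-v.pre⊆ (there (∈-++⁺ʳ ps (there z∈))))))
        refl weight-mid)

      out : All (_∉ R) (u ∷ ps)
      out = All.tabulate λ z∈ z∈R → clash z∈ (insert-⁻ (x ∷ v ∷ ss) z∈R)
        where
        before : ∀ {z} → z ∈ˡ u ∷ ps → z ∈ˡ ps ++ u ∷ ms
        before (here refl) = ∈-++⁺ʳ ps (here refl)
        before (there z∈)  = ∈-++⁺ˡ z∈
        clash : ∀ {z} → z ∈ˡ u ∷ ps → ¬ (z ∈ˡ x ∷ v ∷ ss ⊎ z ∈ ∅)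
        clash z∈ (inj₁ (here refl)) = All.lookup (proj₁ At-v.x≢as) (before z∈) refl
        clash z∈ (inj₁ (there z∈ss)) = proj₂ (proj₂ At-v.uniques) (before z∈ , z∈ss)
        clash z∈ (inj₂ z∈∅) = ∉⊥ z∈∅

      ⊆S : insert (u ∷ ps) R ⊆ S
      ⊆S z∈ with insert-⁻ (u ∷ ps) z∈
      ... | inj₁ z∈ps = insert-∈ {as = x ∷ as} (there (At-u.pre⊆ z∈ps))
      ... | inj₂ z∈R  = At-v.arc⊆S At-v.suf⊆ z∈R

      -- The second arc passes through the base: from `v` onwards to `x`, then along the beginning
      -- of the list to `u`.
      around : Connects S c v u (not (weight w u ms v))
      around = weaken ⊆S (attach
        (subst (Connects R c v x) (trans (cong not (weight-++ w x ps u ms v)) (rearrange (weight w x ps u) _))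
               (Connects-sym At-v.against))
        (proj₁ At-u.walks) At-u.unique-pre out
        (insert-∈ {as = x ∷ v ∷ ss} (there (here refl))) (insert-∈ {as = x ∷ v ∷ ss} (here refl)) At-u.weight-pre)
        where
        rearrange : ∀ a b → not (a xor b) ≡ not b xor a
        rearrange false b = sym (xor-identityʳ (not b))
        rearrange true  b = trans (not-involutive b) (sym (trans (xor-comm (not b) true) (not-involutive b)))

    joined : Joined S c
    joined u v u∈ v∈ u≢v b _ with insert-⁻ (x ∷ as) u∈ | insert-⁻ (x ∷ as) v∈
    ... | inj₂ u∈∅         | _                = ⊥-elim (∉⊥ u∈∅)
    ... | _                | inj₂ v∈∅         = ⊥-elim (∉⊥ v∈∅)
    ... | inj₁ (here refl) | inj₁ (here refl) = ⊥-elim (u≢v refl)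
    ... | inj₁ (here refl) | inj₁ (there v∈as) = from-base v∈as b
    ... | inj₁ (there u∈as) | inj₁ (here refl) = Connects-sym (from-base u∈as b)
    ... | inj₁ (there u∈as) | inj₁ (there v∈as) with ∈-∈-∃++ u∈as v∈as u≢v
    ...   | inj₁ (ps , ms , ss , eq) = Connects-sym (off-base {ps = ps} {ms} {ss} eq b)
    ...   | inj₂ (ps , ms , ss , eq) = off-base {ps = ps} {ms} {ss} eq b

  -- If `w` has a potential, every cycle is even for it and any cycle odd for ψ will do. Otherwise
  -- there is a cycle O odd for `w`; with `b` the value of ψ on O, the weight ψ + `b` · `w` is even
  -- on O, as the signed search requires. On cycles even for `w` this weight agrees with ψ, so the
  -- cycle found is odd for ψ itself.
  balanced-cycle : Supply → ∀ {w ψ} → Symmetric w → Symmetric ψ → ∀ {x y} → Adj x y →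
                   SimpleCycle w ψ false ⊎ ∃[ b ] Potential (λ u v → ψ u v xor (b ∧ w u v))
  balanced-cycle supply {w} {ψ} w-sym ψ-sym xy with grow-from-edge supply w-sym xy
  ... | inj₂ (d , δd) with grow-from-edge supply ψ-sym xy
  ...   | inj₁ C       = inj₁ (record
    { base = base ; interior = interior ; walk = walk ; unique = unique ; weight-ψ = weight-ψ
    ; weight-w = trans (weight-potential d δd walk) (xor-same (d base)) })
    where open SimpleCycle C
  ...   | inj₂ (c , δc) = inj₂ (false , c , λ u v uv → trans (xor-identityʳ _) (δc u v uv))
  balanced-cycle supply {w} {ψ} w-sym ψ-sym xy | inj₁ O
    with grow-from-cycle supply w-sym ψ′-sym walk unique weight-ψ ψ′-even
    where
    open SimpleCycle O
    ψ′ : Weight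
    ψ′ u v = ψ u v xor (weight ψ base interior base ∧ w u v)
    ψ′-sym : Symmetric ψ′
    ψ′-sym u v = cong₂ (λ s t → s xor (weight ψ base interior base ∧ t)) (ψ-sym u v) (w-sym u v)
    a = weight ψ base interior base
    ψ′-even : weight ψ′ base interior base ≡ false
    ψ′-even = begin
      weight ψ′ base interior base               ≡⟨ weight-combination a ψ w base interior base ⟩
      a xor (a ∧ weight w base interior base)    ≡⟨ cong (λ t → a xor (a ∧ t)) weight-ψ ⟩
      a xor (a ∧ true)                           ≡⟨ cong (a xor_) (∧-identityʳ a) ⟩
      a xor a                                    ≡⟨ xor-same a ⟩
      false                                      ∎
      where open ≡-Reasoning
  ... | inj₂ δ = inj₂ (weight ψ (SimpleCycle.base O) (SimpleCycle.interior O) (SimpleCycle.base O) , δ)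
  ... | inj₁ C = inj₁ (record
    { base = base ; interior = interior ; walk = walk ; unique = unique ; weight-w = weight-w
    ; weight-ψ = trans (trans (sym (xor-identityʳ _)) (cong (weight ψ base interior base xor_)
        (sym (trans (cong (b ∧_) weight-w) (∧-zeroʳ b)))))
        (trans (sym (weight-combination b ψ w base interior base)) weight-ψ) })
    where
    open SimpleCycle C
    b = weight ψ (SimpleCycle.base O) (SimpleCycle.interior O) (SimpleCycle.base O)

-- Stars, faces and ears in a polyhedral map.

module MapFacts (K : PolyhedralMap) where
  open PolyhedralMap K

  Joins-sym : ∀ {e u v} → Joins e u v → Joins e v u
  Joins-sym = Sum.swap

  Joins-ends : ∀ {e a b c d} → Joins e a b → Joins e c d → (c ≡ a × d ≡ b) ⊎ (c ≡ b × d ≡ a)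
  Joins-ends (inj₁ r) (inj₁ s) with trans (sym r) s
  ... | refl = inj₁ (refl , refl)
  Joins-ends (inj₁ r) (inj₂ s) with trans (sym r) s
  ... | refl = inj₂ (refl , refl)
  Joins-ends (inj₂ r) (inj₁ s) with trans (sym r) s
  ... | refl = inj₂ (refl , refl)
  Joins-ends (inj₂ r) (inj₂ s) with trans (sym r) s
  ... | refl = inj₁ (refl , refl)

  Joins-unique : ∀ {e u v v′} → Joins e u v → Joins e u v′ → v ≡ v′
  Joins-unique j j′ with Joins-ends j j′
  ... | inj₁ (_ , eq)    = sym eq
  ... | inj₂ (eq , eq′) = sym (trans eq′ eq)

  Joins-∈ᵉ : ∀ {e u v w} → Joins e u v → w ∈ᵉ e → w ≡ u ⊎ w ≡ v
  Joins-∈ᵉ j (_ , j′) with Joins-ends j j′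
  ... | inj₁ (eq , _) = inj₁ eq
  ... | inj₂ (eq , _) = inj₂ eq

  Joins? : ∀ e u v → Dec (Joins e u v)
  Joins? e u v = ≡-dec _≟_ _≟_ (ends e) (u , v) ⊎-dec ≡-dec _≟_ _≟_ (ends e) (v , u)

  Adjacent? : ∀ u v → Dec (Adjacent u v)
  Adjacent? u v = any? λ e → Joins? e u v

  Adjacent-sym : ∀ {u v} → Adjacent u v → Adjacent v u
  Adjacent-sym (e , j) = e , Joins-sym j

  Adjacent-irrefl : ∀ {u} → ¬ Adjacent u u
  Adjacent-irrefl (e , j) = loopless e _ j

  _⊂ᶠ?_ : ∀ e f → Dec (e ⊂ᶠ f)
  e ⊂ᶠ? f = any? λ i → Joins? e (boundary f i) (boundary f (next i))

  ⊂ᶠ⇒∈ᶠ : ∀ {e f u v} → e ⊂ᶠ f → Joins e u v → u ∈ᶠ f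
  ⊂ᶠ⇒∈ᶠ (i , j) j′ with Joins-ends j j′
  ... | inj₁ (eq , _) = i , sym eq
  ... | inj₂ (eq , _) = next i , sym eq

  neighbours : ∀ {e f i u v} → e ⊂ᶠ f → boundary f i ≡ u → Joins e u v →
               v ≡ boundary f (next i) ⊎ v ≡ boundary f (prev i)
  neighbours {f = f} (k , j) refl j′ with Joins-ends j j′
  ... | inj₁ (eq , eq′) = inj₁ (trans eq′ (cong (boundary f ∘ next) (sym (boundary-injective f eq))))
  ... | inj₂ (eq , eq′) =
    inj₂ (trans eq′ (cong (boundary f) (trans (sym (prev-next k)) (cong prev (sym (boundary-injective f eq))))))

  spoke≢next : ∀ u k → spoke u k ≢ spoke u (next k)
  spoke≢next u k eq = next≢ (≤-trans (n≤1+n 2) (degree≥3 u)) k (sym (spoke-injective u eq))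

  star≢prev : ∀ u k → star u k ≢ star u (prev k)
  star≢prev u k eq = next≢ (≤-trans (n≤1+n 2) (degree≥3 u)) (prev k)
    (trans (next-prev k) (star-injective u eq))

  spoke⊂prev : ∀ u k → spoke u k ⊂ᶠ star u (prev k)
  spoke⊂prev u k = subst (λ l → spoke u l ⊂ᶠ star u (prev k)) (next-prev k) (spoke-second u (prev k))

  spoke-across : ∀ u k → Across (spoke u k) (star u k) (star u (prev k))
  spoke-across u k = star≢prev u k , spoke-first u k , spoke⊂prev u k

  ∈ᶠ-star : ∀ u k → u ∈ᶠ star u k
  ∈ᶠ-star u k = ⊂ᶠ⇒∈ᶠ (spoke-first u k) (proj₂ (spoke-incident u k))

  -- Only two edges of an embedded polygon meet at one of its vertices, and the two spokes are
  -- distinct edges of this kind.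
  edge-of-star : ∀ {u e k} → e ⊂ᶠ star u k → u ∈ᵉ e → e ≡ spoke u k ⊎ e ≡ spoke u (next k)
  edge-of-star {u} {e} {k} e⊂ (v , j) with ∈ᶠ-star u k | spoke-incident u k | spoke-incident u (next k)
  ... | i , u≡ | v₁ , j₁ | v₂ , j₂
    with neighbours e⊂ u≡ j | neighbours (spoke-first u k) u≡ j₁ | neighbours (spoke-second u k) u≡ j₂
  ... | inj₁ refl | inj₁ refl | _         = inj₁ (simple _ _ _ _ j j₁)
  ... | inj₁ refl | inj₂ _    | inj₁ refl = inj₂ (simple _ _ _ _ j j₂)
  ... | inj₂ refl | inj₂ refl | _         = inj₁ (simple _ _ _ _ j j₁)
  ... | inj₂ refl | inj₁ _    | inj₂ refl = inj₂ (simple _ _ _ _ j j₂)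
  ... | inj₁ _    | inj₂ refl | inj₂ refl = ⊥-elim (spoke≢next u k (simple _ _ _ _ j₁ j₂))
  ... | inj₂ _    | inj₁ refl | inj₁ refl = ⊥-elim (spoke≢next u k (simple _ _ _ _ j₁ j₂))

  spoke-index : ∀ {u e} → u ∈ᵉ e → ∃[ k ] spoke u k ≡ e
  spoke-index {u} {e} u∈e@(v , j) with edge-in-face e
  ... | f , e⊂f with star-complete u f (⊂ᶠ⇒∈ᶠ e⊂f j)
  ... | k , refl with edge-of-star {u} {e} {k} e⊂f u∈e
  ... | inj₁ eq = k , sym eq
  ... | inj₂ eq = next k , sym eq

  -- Such a face contains `u`, hence is some `star u l`, and the edge is one of its two spokes
  -- there; injectivity of `spoke u` pins down `l`.
  face-of-spoke : ∀ {u k f} → spoke u k ⊂ᶠ f → f ≡ star u k ⊎ f ≡ star u (prev k)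
  face-of-spoke {u} {k} {f} e⊂f with star-complete u f (⊂ᶠ⇒∈ᶠ e⊂f (proj₂ (spoke-incident u k)))
  ... | l , refl with edge-of-star {u} {spoke u k} {l} e⊂f (spoke-incident u k)
  ... | inj₁ eq = inj₁ (cong (star u) (sym (spoke-injective u eq)))
  ... | inj₂ eq = inj₂ (cong (star u) (trans (sym (prev-next l)) (cong prev (sym (spoke-injective u eq)))))

  across-spoke : ∀ {u k f g} → Across (spoke u k) f g →
                 (f ≡ star u k × g ≡ star u (prev k)) ⊎ (f ≡ star u (prev k) × g ≡ star u k)
  across-spoke {u} {k} (f≢g , e⊂f , e⊂g) with face-of-spoke {u} {k} e⊂f | face-of-spoke {u} {k} e⊂g
  ... | inj₁ f≡ | inj₂ g≡ = inj₁ (f≡ , g≡)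
  ... | inj₂ f≡ | inj₁ g≡ = inj₂ (f≡ , g≡)
  ... | inj₁ f≡ | inj₁ g≡ = ⊥-elim (f≢g (trans f≡ (sym g≡)))
  ... | inj₂ f≡ | inj₂ g≡ = ⊥-elim (f≢g (trans f≡ (sym g≡)))

  first : ∀ {n} → 3 ≤ n → Fin n
  first (s≤s _) = zero

  -- The dual graph is connected: the property travels round the star of a vertex, and a face at an
  -- edge hands it from the star of one end to that of the other.
  all-faces : (P : Face → Set) → (∀ {e f g} → Across e f g → P f → P g) → ∀ {f} → P f → ∀ g → P g
  all-faces P spread {f} Pf g =
    fromVertex (proj₂ (faceVertex g)) (fold (connected _ _) (toVertex (proj₂ (faceVertex f)) Pf))
    where
    Q : Vertex → Set
    Q u = ∀ k → P (star u k)
    faceVertex : ∀ f → ∃[ u ] u ∈ᶠ f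
    faceVertex f = _ , first (size≥3 f) , refl
    toVertex : ∀ {u f} → u ∈ᶠ f → P f → Q u
    toVertex {u} {f} u∈f Pf with star-complete u f u∈f
    ... | i , refl = next-induction (λ k → P (star u k)) Pf
      λ k → spread {e = spoke u (next k)}
        ((λ eq → spoke≢next u k (cong (spoke u) (star-injective u eq))) , spoke-second u k , spoke-first u (next k))
    fromVertex : ∀ {u f} → u ∈ᶠ f → Q u → P f
    fromVertex {u} {f} u∈f Qu with star-complete u f u∈f
    ... | i , refl = Qu i
    move : ∀ {u v} → Adjacent u v → Q u → Q v
    move (e , j) Qu with edge-in-face e
    ... | f , e⊂f = toVertex (⊂ᶠ⇒∈ᶠ e⊂f (Joins-sym j)) (fromVertex (⊂ᶠ⇒∈ᶠ e⊂f j) Qu)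
    fold : ∀ {u v} → Star Adjacent u v → Q u → Q v
    fold ε        Qu = Qu
    fold (a ◅ as) Qu = fold as (move a Qu)

  open SignedGraph Adjacent Adjacent? Adjacent-sym Adjacent-irrefl public

  tabulate-walk : ∀ {m} (c : Fin (suc (suc m)) → Vertex) → (∀ k → Adjacent (c (inject₁ k)) (c (suc k))) →
                  Walk (c zero) (tabulate (λ k → c (suc (inject₁ k)))) (c (fromℕ (suc m)))
  tabulate-walk {zero}  c adj = [ adj zero ]
  tabulate-walk {suc m} c adj = adj zero ∷ tabulate-walk (c ∘ suc) (adj ∘ suc)

  tabulate-∷ʳ : ∀ {m} (c : Fin (suc m) → Vertex) →
                tabulate (λ k → c (inject₁ k)) ∷ʳ c (fromℕ m) ≡ tabulate c
  tabulate-∷ʳ {zero}  c = refl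
  tabulate-∷ʳ {suc m} c = cong (c zero ∷_) (tabulate-∷ʳ (c ∘ suc))

  -- Renumbers a face boundary so that the edge from `i` to `next i` becomes the wrap-around edge,
  -- leaving the rest as one linear walk.
  record Rotating {n} (i : Fin (suc n)) : Set where
    field
      rot            : Fin (suc n) → Fin (suc n)
      rot-next       : ∀ k → rot (next k) ≡ next (rot k)
      rot-last       : rot (fromℕ n) ≡ i
      rot-injective  : ∀ {k l} → rot k ≡ rot l → k ≡ l
      rot-surjective : ∀ k → ∃[ l ] rot l ≡ k

  rotating : ∀ {n} (i : Fin (suc n)) → Rotating i
  rotating {n} = next-induction Rotating {fromℕ n}
    (record { rot = id ; rot-next = λ _ → refl ; rot-last = refl ; rot-injective = id ; rot-surjective = λ k → k , refl })
    λ i R → let open Rotating R in record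
      { rot            = next ∘ rot
      ; rot-next       = λ k → cong next (rot-next k)
      ; rot-last       = cong next rot-last
      ; rot-injective  = rot-injective ∘ next-injective
      ; rot-surjective = λ k → let l , eq = rot-surjective (prev k) in l , trans (cong next eq) (next-prev k) }

  -- Removing the edge with both ends in `S` turns the boundary into a simple walk between nodes of
  -- `S` that passes through `b j` outside.
  boundary-ear : ∀ S {n} (b : Fin (suc (suc n)) → Vertex) → (∀ {i j} → b i ≡ b j → i ≡ j) →
                 (∀ i → Adjacent (b i) (b (next i))) → ∀ i j → b i ∈ S → b (next i) ∈ S → b j ∉ S →
                 Σ (Ear S) λ E → ∃₂ λ a bs → Ear.between E ≡ a ∷ bs
  boundary-ear S {n} b b-inj b-adj i j i∈ i′∈ j∉ =
    walk-ear S (tabulate-walk c adj) start∈ end∈ uniq outside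
    where
    open Rotating (rotating i)
    c : Fin (suc (suc n)) → Vertex
    c = b ∘ rot
    adj : ∀ k → Adjacent (c (inject₁ k)) (c (suc k))
    adj k = subst (Adjacent _) (cong b (trans (sym (rot-next (inject₁ k))) (cong rot (next-inject₁ k)))) (b-adj _)
    start∈ : c zero ∈ S
    start∈ = subst (λ k → b k ∈ S)
      (trans (cong next (sym rot-last)) (trans (sym (rot-next _)) (cong rot (next-fromℕ (suc n))))) i′∈
    end∈ : c (fromℕ (suc n)) ∈ S
    end∈ = subst (λ k → b k ∈ S) (sym rot-last) i∈
    uniq : Unique (c zero ∷ tabulate (λ k → c (suc (inject₁ k))) ∷ʳ c (fromℕ (suc n)))
    uniq = subst (λ as → Unique (c zero ∷ as)) (sym (tabulate-∷ʳ (c ∘ suc)))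
      (tabulate⁺ {f = c} (rot-injective ∘ b-inj))
    outside : Any (_∉ S) (tabulate (λ k → c (suc (inject₁ k))))
    outside with rot-surjective j
    ... | zero , refl = ⊥-elim (j∉ start∈)
    ... | suc k , refl with view k
    ...   | ‵fromℕ     = ⊥-elim (j∉ end∈)
    ...   | ‵inject₁ l = Any.tabulate⁺ l j∉

  face-ear : ∀ S f i j → boundary f i ∈ S → boundary f (next i) ∈ S → boundary f j ∉ S →
             Σ (Ear S) λ E → ∃₂ λ a bs → Ear.between E ≡ a ∷ bs
  face-ear S f with size f | size≥3 f | boundary f | boundary-injective f | boundary-edges f
  ... | suc (suc n) | _ | b | b-inj | b-adj = boundary-ear S b b-inj b-adj
  ... | suc zero | s≤s () | _ | _ | _

  -- If no face boundary provides an ear, every face with an edge whose ends lie in `S` has all its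
  -- vertices in `S`. Its neighbours across edges are then such faces too, so all faces are
  -- swallowed.
  supply : Supply
  supply S {u} {v} u∈ v∈ (e , uv)
    with any? (λ f → any? λ i → any? λ j → boundary f i ∈? S ×-dec boundary f (next i) ∈? S ×-dec ¬? (boundary f j ∈? S))
  ... | yes (f , i , j , i∈ , i′∈ , j∉) = inj₂ (face-ear S f i j i∈ i′∈ j∉)
  ... | no  closed = inj₁ everything
    where
    Inside : Face → Set
    Inside f = ∀ j → boundary f j ∈ S
    fill : ∀ {e f x y} → e ⊂ᶠ f → Joins e x y → x ∈ S → y ∈ S → Inside f
    fill {f = f} (i , j′) j x∈ y∈ k with Joins-ends j j′
    ... | inj₁ (eq , eq′) = decidable-stable (_ ∈? S) λ k∉ →
      closed (f , i , k , subst (_∈ S) (sym eq) x∈ , subst (_∈ S) (sym eq′) y∈ , k∉)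
    ... | inj₂ (eq , eq′) = decidable-stable (_ ∈? S) λ k∉ →
      closed (f , i , k , subst (_∈ S) (sym eq) y∈ , subst (_∈ S) (sym eq′) x∈ , k∉)
    spread : ∀ {e f g} → Across e f g → Inside f → Inside g
    spread (_ , (i , j) , e⊂g) inside = fill e⊂g j (inside i) (inside (next i))
    everything : ∀ z → z ∈ S
    everything z with ∈ᶠ-star z (first (degree≥3 z))
    ... | i , eq = subst (_∈ S) eq (all-faces Inside spread (fill (proj₂ (edge-in-face e)) uv u∈ v∈) _ i)

-- Reachability and cyclic intervals.

lookup-injective : ∀ {X : Set} {xs : List X} → Unique xs → ∀ {i j} → lookup xs i ≡ lookup xs j → i ≡ j
lookup-injective (_  ∷ _) {zero}  {zero}  _  = refl
lookup-injective (x≢ ∷ _) {zero}  {suc j} eq = ⊥-elim (All.lookup x≢ (∈-lookup j) eq)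
lookup-injective (x≢ ∷ _) {suc i} {zero}  eq = ⊥-elim (All.lookup x≢ (∈-lookup i) (sym eq))
lookup-injective (_  ∷ u) {suc i} {suc j} eq = cong suc (lookup-injective u eq)

reachable : ∀ {n} {R : Fin n → Fin n → Set} → (∀ x y → Dec (R x y)) → ∀ a →
            Σ (Subset n) λ D → a ∈ D × (∀ {x} → x ∈ D → Star R a x) × (∀ {x y} → x ∈ D → R x y → y ∈ D)
reachable {n} {R} R? a = close ⁅ a ⁆ (x∈⁅x⁆ a) (λ x∈ → subst (Star R a) (sym (x∈⁅y⁆⇒x≡y a x∈)) ε) (⊃-wellFounded ⁅ a ⁆)
  where
  close : ∀ D → a ∈ D → (∀ {x} → x ∈ D → Star R a x) → Acc _⊃_ D →
          Σ (Subset n) λ D → a ∈ D × (∀ {x} → x ∈ D → Star R a x) × (∀ {x y} → x ∈ D → R x y → y ∈ D)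
  close D a∈ reach (acc rec) with any? (λ x → any? λ y → x ∈? D ×-dec ¬? (y ∈? D) ×-dec R? x y)
  ... | no  closed = D , a∈ , reach , λ x∈ r → decidable-stable (_ ∈? D) λ y∉ → closed (_ , _ , x∈ , y∉ , r)
  ... | yes (x , y , x∈ , y∉ , r) =
    close (⁅ y ⁆ ∪ D) (x∈p∪q⁺ (inj₂ a∈)) reach′ (rec (x∈p∪q⁺ ∘ inj₂ , y , x∈p∪q⁺ (inj₁ (x∈⁅x⁆ y)) , y∉))
    where
    reach′ : ∀ {z} → z ∈ ⁅ y ⁆ ∪ D → Star R a z
    reach′ z∈ with x∈p∪q⁻ ⁅ y ⁆ D z∈
    ... | inj₁ z∈y = subst (Star R a) (sym (x∈⁅y⁆⇒x≡y y z∈y)) (reach x∈ ◅◅ r ◅ ε)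
    ... | inj₂ z∈D = reach z∈D

-- Going round a cycle, this changes exactly on entering a and on entering b.
arc : ∀ {n} → Fin n → Fin n → Fin n → Bool
arc a b k = does (toℕ a ℕ.≤? toℕ k) xor does (toℕ b ℕ.≤? toℕ k)

-- Each of the two thresholds also flips where the index wraps to zero; in their sum these flips
-- cancel.
arc-next : ∀ {n} (a b k : Fin n) →
           arc a b (next k) ≡ arc a b k xor (does (next k ≟ a) xor does (next k ≟ b))
arc-next {n} a b k = combine-steps _ (le a) _ (le b) (does (next k ≟ a)) (does (next k ≟ b)) wraps (threshold a) (threshold b)
  where
  le : Fin n → Bool
  le a = does (toℕ a ℕ.≤? toℕ k)
  wraps : Bool
  wraps = does (toℕ (next k) ℕ.≟ 0)
  threshold : ∀ a → does (toℕ a ℕ.≤? toℕ (next k)) ≡ does (toℕ a ℕ.≤? toℕ k) xor (does (next k ≟ a) xor wraps)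
  threshold a with toℕ-next k
  ... | inj₁ eq rewrite dec-false (toℕ (next k) ℕ.≟ 0) (λ e → 0≢1+n (trans (sym e) eq)) with next k ≟ a
  ...   | yes refl = trans (dec-true (toℕ (next k) ℕ.≤? toℕ (next k)) ≤-refl)
    (sym (cong (_xor true) (dec-false (toℕ (next k) ℕ.≤? toℕ k) (λ le → 1+n≰n (subst (ℕ._≤ toℕ k) eq le)))))
  ...   | no  ne = trans (does-⇔ (mk⇔
      (λ le → ≤-pred (≤∧≢⇒< (subst (toℕ a ℕ.≤_) eq le)
        (λ e → ne (toℕ-injective (trans eq (sym e))))  ))
      (λ le → subst (toℕ a ℕ.≤_) (sym eq) (m≤n⇒m≤1+n le))) (_ ℕ.≤? _) (_ ℕ.≤? _)) (sym (xor-identityʳ _))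
  threshold a | inj₂ (eq , eq′)
    rewrite dec-true (toℕ (next k) ℕ.≟ 0) eq
          | dec-true (toℕ a ℕ.≤? toℕ k) (≤-pred (subst (toℕ a ℕ.<_) (sym eq′) (toℕ<n a))) =
    trans (does-⇔ (mk⇔ (λ le → toℕ-injective (trans eq (sym (n≤0⇒n≡0 (subst (toℕ a ℕ.≤_) eq le)))))
                       (λ { refl → ≤-refl })) (_ ℕ.≤? _) (next k ≟ a))
          (sym (trans (cong not (xor-comm _ true)) (not-involutive _)))
  combine-steps : ∀ a′ a b′ b x y z → a′ ≡ a xor (x xor z) → b′ ≡ b xor (y xor z) →
                  a′ xor b′ ≡ (a xor b) xor (x xor y)
  combine-steps _ a _ b x y z refl refl =
    solve 5 (λ a b x y z → (a :+ (x :+ z)) :+ (b :+ (y :+ z)) := (a :+ b) :+ (x :+ y)) refl a b x y z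

arc-ends : ∀ {n} {a b : Fin n} → a ≢ b → arc a b b ≡ not (arc a b a)
arc-ends {a = a} {b} a≢b with ≤-total (toℕ a) (toℕ b)
... | inj₁ a≤b
  rewrite dec-true (toℕ a ℕ.≤? toℕ a) ≤-refl | dec-true (toℕ b ℕ.≤? toℕ b) ≤-refl
        | dec-true (toℕ a ℕ.≤? toℕ b) a≤b
        | dec-false (toℕ b ℕ.≤? toℕ a) (λ b≤a → a≢b (toℕ-injective (≤-antisym a≤b b≤a))) = refl
... | inj₂ b≤a
  rewrite dec-true (toℕ a ℕ.≤? toℕ a) ≤-refl | dec-true (toℕ b ℕ.≤? toℕ b) ≤-refl
        | dec-true (toℕ b ℕ.≤? toℕ a) b≤a
        | dec-false (toℕ a ℕ.≤? toℕ b) (λ a≤b → a≢b (toℕ-injective (≤-antisym a≤b b≤a))) = refl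

-- Twisted edges, and simple cycles as cycles of the map.

module Orientation (K : PolyhedralMap) where
  open PolyhedralMap K
  open MapFacts K

  -- The numbering of the star orients the surface at each vertex.  Since star u i lies on the
  -- same side of spoke u i for every u and i, the orientations at the two ends of an edge
  -- disagree exactly when the edge is twisted.
  Twisted : Vertex → Vertex → Set
  Twisted u v = ∃[ e ] ∃[ i ] ∃[ j ] (Joins e u v × spoke u i ≡ e × spoke v j ≡ e × star u i ≡ star v j)

  Twisted? : ∀ u v → Dec (Twisted u v)
  Twisted? u v = any? λ e → any? λ i → any? λ j →
    Joins? e u v ×-dec spoke u i ≟ e ×-dec spoke v j ≟ e ×-dec star u i ≟ star v j

  twist : Weight
  twist u v = does (Twisted? u v)

  Twisted-sym : ∀ {u v} → Twisted u v → Twisted v u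
  Twisted-sym (e , i , j , uv , eq , eq′ , same) = e , j , i , Joins-sym uv , eq′ , eq , sym same

  twist-sym : Symmetric twist
  twist-sym u v = does-⇔ (mk⇔ Twisted-sym Twisted-sym) (Twisted? u v) (Twisted? v u)

  twist-value : ∀ {e u v i j} → Joins e u v → spoke u i ≡ e → spoke v j ≡ e →
                twist u v ≡ does (star u i ≟ star v j)
  twist-value {e} {u} {v} {i} {j} uv eq eq′ = does-⇔
    (mk⇔ (λ { (e″ , k , l , uv″ , eqk , eql , same) →
                let e″≡e = simple e″ e u v uv″ uv
                    k≡i = spoke-injective u (trans eqk (trans e″≡e (sym eq)))
                    l≡j = spoke-injective v (trans eql (trans e″≡e (sym eq′)))
                in trans (cong (star u) (sym k≡i)) (trans same (cong (star v) l≡j)) })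
         (λ same → e , i , j , uv , eq , eq′ , same))
    (Twisted? u v) (star u i ≟ star v j)

  -- Transfers edge functions to the weights of the graph search; at most one edge joins a given
  -- pair, so nothing is lost.
  onPairs : (Edge → Bool) → Weight
  onPairs ψ u v = does (any? λ e → Joins? e u v ×-dec ψ e Bool.≟ true)

  onPairs-sym : ∀ ψ → Symmetric (onPairs ψ)
  onPairs-sym ψ u v = does-⇔ (mk⇔ flip flip) (any? λ e → Joins? e u v ×-dec ψ e Bool.≟ true)
    (any? λ e → Joins? e v u ×-dec ψ e Bool.≟ true)
    where
    flip : ∀ {u v} → ∃[ e ] (Joins e u v × ψ e ≡ true) → ∃[ e ] (Joins e v u × ψ e ≡ true)
    flip (e , uv , eq) = e , Joins-sym uv , eq

  onPairs-edge : ∀ ψ {e u v} → Joins e u v → onPairs ψ u v ≡ ψ e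
  onPairs-edge ψ {e} {u} {v} uv with ψ e in eq
  ... | true  = dec-true (any? λ e → Joins? e u v ×-dec ψ e Bool.≟ true) (e , uv , eq)
  ... | false = dec-false (any? λ e → Joins? e u v ×-dec ψ e Bool.≟ true)
    λ { (e′ , uv′ , eq′) → true≢false (trans (sym eq′) (trans (cong ψ (simple e′ e u v uv′ uv)) eq)) }

  walk-adjacent : ∀ {x as y} → Walk x as y →
                  (∀ k → Adjacent (lookup (x ∷ as) (inject₁ k)) (lookup as k)) ×
                  Adjacent (lookup (x ∷ as) (fromℕ (length as))) y
  walk-adjacent [ e ]   = (λ ()) , e
  walk-adjacent (e ∷ w) = let adj , last = walk-adjacent w in (λ { zero → e ; (suc k) → adj k }) , last

  walk-sum : ∀ ℓ x as y →
             sum (λ k → ℓ (lookup (x ∷ as) (inject₁ k)) (lookup as k)) xor ℓ (lookup (x ∷ as) (fromℕ (length as))) y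
             ≡ weight ℓ x as y
  walk-sum ℓ x []       y = refl
  walk-sum ℓ x (a ∷ as) y = trans (xor-assoc (ℓ x a) _ _) (cong (ℓ x a xor_) (walk-sum ℓ a as y))

  module _ {w ψ b} (ψ-sym : Symmetric ψ) (S : SimpleCycle w ψ b) where
    open SimpleCycle S

    -- `SimpleCycle` admits running along an edge and back, but a symmetric weight is even there
    -- while ψ is odd.
    interior≥2 : 2 ≤ length interior
    interior≥2 = long interior walk weight-ψ
      where
      long : ∀ {x} as → Walk x as x → weight ψ x as x ≡ true → 2 ≤ length as
      long []             [ e ] _ = ⊥-elim (Adjacent-irrefl e)
      long {x} (a ∷ [])   w h with trans (sym h) (trans (cong (ψ x a xor_) (ψ-sym a x)) (xor-same (ψ x a)))
      ... | ()
      long (a ∷ a′ ∷ as)  w h = s≤s (s≤s z≤n)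

    toCycle : Cycle K
    toCycle = record
      { length    = suc (length interior)
      ; length≥3  = s≤s interior≥2
      ; at        = lookup (base ∷ interior)
      ; injective = lookup-injective unique
      ; adjacent  = adj }
      where
      adj : ∀ j → Adjacent (lookup (base ∷ interior) j) (lookup (base ∷ interior) (next j))
      adj j with view j
      ... | ‵fromℕ     = subst (λ k → Adjacent (lookup (base ∷ interior) (fromℕ (length interior))) (lookup (base ∷ interior) k))
                           (sym (next-fromℕ (length interior))) (proj₂ (walk-adjacent walk))
      ... | ‵inject₁ k = subst (λ l → Adjacent (lookup (base ∷ interior) (inject₁ k)) (lookup (base ∷ interior) l))
                           (sym (next-inject₁ k)) (proj₁ (walk-adjacent walk) k)

    toCycle-sum : ∀ ℓ → let open Cycle toCycle in
                  sum (λ j → ℓ (at j) (at (next j))) ≡ weight ℓ base interior base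
    toCycle-sum ℓ = begin
      sum t                                                                      ≡⟨ sum-init-last t ⟩
      sum (λ k → t (inject₁ k)) xor t (fromℕ (length interior))                  ≡⟨ cong₂ _xor_
        (sum-cong-≗ λ k → cong (λ l → ℓ (lookup L (inject₁ k)) (lookup L l)) (next-inject₁ k))
        (cong (λ l → ℓ (lookup L (fromℕ (length interior))) (lookup L l)) (next-fromℕ (length interior))) ⟩
      sum (λ k → ℓ (lookup L (inject₁ k)) (lookup interior k)) xor ℓ (lookup L (fromℕ (length interior))) base
                                                                                 ≡⟨ walk-sum ℓ base interior base ⟩
      weight ℓ base interior base                                                ∎
      where
      open ≡-Reasoning
      L = base ∷ interior
      t : Fin (suc (length interior)) → Bool
      t j = ℓ (lookup L j) (lookup L (next j))

-- Edges and spokes along a cycle.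

module AlongCycle (K : PolyhedralMap) (C : Cycle K) where
  open PolyhedralMap K
  open MapFacts K
  open Orientation K
  open Cycle C renaming (length to len; injective to at-injective)

  edge : Fin len → Edge
  edge j = proj₁ (adjacent j)

  edge-joins : ∀ j → Joins (edge j) (at j) (at (next j))
  edge-joins j = proj₂ (adjacent j)

  edge-prev-joins : ∀ j → Joins (edge (prev j)) (at (prev j)) (at j)
  edge-prev-joins j = subst (λ k → Joins (edge (prev j)) (at (prev j)) (at k)) (next-prev j) (edge-joins (prev j))

  edge-EdgeOf : ∀ j → EdgeOf (edge j)
  edge-EdgeOf j = j , edge-joins j

  EdgeOf? : ∀ e → Dec (EdgeOf e)
  EdgeOf? e = any? λ j → Joins? e (at j) (at (next j))

  EdgeOf-edge : ∀ {e} → EdgeOf e → ∃[ j ] edge j ≡ e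
  EdgeOf-edge (j , joins) = j , simple _ _ _ _ (edge-joins j) joins

  edge≢prev : ∀ j → edge j ≢ edge (prev j)
  edge≢prev j eq = next²≢ length≥3 (prev j) (trans (cong next (next-prev j))
    (at-injective (Joins-unique (subst (λ e → Joins e _ _) eq (edge-joins j)) (Joins-sym (edge-prev-joins j)))))

  -- Equal edges traversed in opposite directions would force the cycle to have length two.
  edge-injective : ∀ {i j} → edge i ≡ edge j → i ≡ j
  edge-injective {i} {j} eq with Joins-ends (edge-joins i) (subst (λ e → Joins e _ _) (sym eq) (edge-joins j))
  ... | inj₁ (at≡ , _) = sym (at-injective at≡)
  ... | inj₂ (at≡ , at≡′) = ⊥-elim (next²≢ length≥3 i
    (trans (cong next (sym (at-injective at≡))) (at-injective at≡′)))

  EdgeOf-at : ∀ {e j} → EdgeOf e → at j ∈ᵉ e → e ≡ edge j ⊎ e ≡ edge (prev j)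
  EdgeOf-at {e} {j} E at∈ with EdgeOf-edge E
  ... | k , refl with Joins-∈ᵉ (edge-joins k) at∈
  ... | inj₁ eq = inj₁ (cong edge (sym (at-injective eq)))
  ... | inj₂ eq = inj₂ (cong edge (trans (sym (prev-next k)) (cong prev (sym (at-injective eq)))))

  out-spoke : ∀ j → ∃[ k ] spoke (at j) k ≡ edge j
  out-spoke j = spoke-index (_ , edge-joins j)

  in-spoke : ∀ j → ∃[ k ] spoke (at j) k ≡ edge (prev j)
  in-spoke j = spoke-index (_ , Joins-sym (edge-prev-joins j))

  out in′ : ∀ j → Fin (degree (at j))
  out j = proj₁ (out-spoke j)
  in′ j = proj₁ (in-spoke j)

  out≢in : ∀ j → out j ≢ in′ j
  out≢in j eq = edge≢prev j
    (trans (sym (proj₂ (out-spoke j))) (trans (cong (spoke (at j)) eq) (proj₂ (in-spoke j))))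

  EdgeOf-spoke : ∀ {j k} → EdgeOf (spoke (at j) k) → k ≡ out j ⊎ k ≡ in′ j
  EdgeOf-spoke {j} {k} E with EdgeOf-at E (spoke-incident (at j) k)
  ... | inj₁ eq = inj₁ (spoke-injective (at j) (trans eq (sym (proj₂ (out-spoke j)))))
  ... | inj₂ eq = inj₂ (spoke-injective (at j) (trans eq (sym (proj₂ (in-spoke j)))))

  out-EdgeOf : ∀ j → EdgeOf (spoke (at j) (out j))
  out-EdgeOf j = subst EdgeOf (sym (proj₂ (out-spoke j))) (edge-EdgeOf j)

  in-EdgeOf : ∀ j → EdgeOf (spoke (at j) (in′ j))
  in-EdgeOf j = subst EdgeOf (sym (proj₂ (in-spoke j))) (edge-EdgeOf (prev j))

  in-next : ∀ j → spoke (at (next j)) (in′ (next j)) ≡ edge j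
  in-next j = trans (proj₂ (in-spoke (next j))) (cong edge (prev-next j))

  divides-face-cycles : DividesFaceCycles K C
  divides-face-cycles j =
    in′ (next j) , out (next j) , (λ eq → out≢in (next j) (sym eq)) ,
    subst (λ e → Joins e (at (next j)) (at j)) (sym (in-next j)) (Joins-sym (edge-joins j)) ,
    subst (λ e → Joins e (at (next j)) (at (next (next j)))) (sym (proj₂ (out-spoke (next j)))) (edge-joins (next j))

-- Colouring the two sides of a cycle with even twist.

module TwoSided (K : PolyhedralMap) (C : Cycle K) where
  open PolyhedralMap K
  open MapFacts K
  open Orientation K
  open AlongCycle K C
  open Cycle C renaming (length to len; injective to at-injective)

  colour : Bool → Side K C
  colour false = A
  colour true  = B

  colour-injective : ∀ {x y} → colour x ≡ colour y → x ≡ y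
  colour-injective {false} {false} _ = refl
  colour-injective {true}  {true}  _ = refl

  module _ (untwisted : sum (λ j → twist (at j) (at (next j))) ≡ false) where

    -- Whether the numbering of the star at `at j` is reversed relative to the one at the start of
    -- C, compared along C. `untwisted` makes this well defined after a full turn.
    turn : Fin len → Bool
    turn = partial-sum (λ j → twist (at j) (at (next j)))

    turn-next : ∀ j → turn (next j) ≡ turn j xor twist (at j) (at (next j))
    turn-next = cyclic-primitive (λ j → twist (at j) (at (next j))) untwisted

    -- false from the outgoing edge of C up to the incoming one, true from there on.
    local : ∀ j → Fin (degree (at j)) → Bool
    local j k = arc (out j) (in′ j) k xor arc (out j) (in′ j) (out j)

    local-out : ∀ j → local j (out j) ≡ false
    local-out j = xor-same (arc (out j) (in′ j) (out j))

    local-in : ∀ j → local j (in′ j) ≡ true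
    local-in j = trans (cong (_xor arc (out j) (in′ j) (out j)) (arc-ends (out≢in j)))
                       (not-xor (arc (out j) (in′ j) (out j)))
      where
      not-xor : ∀ b → not b xor b ≡ true
      not-xor false = refl
      not-xor true  = refl

    crossing : ∀ {j} → Fin (degree (at j)) → Bool
    crossing {j} k = does (k ≟ out j) xor does (k ≟ in′ j)

    local-prev : ∀ j k → local j k ≡ local j (prev k) xor crossing k
    local-prev j k = begin
      arc (out j) (in′ j) k xor o                         ≡⟨ cong (λ l → arc (out j) (in′ j) l xor o) (next-prev k) ⟨
      arc (out j) (in′ j) (next (prev k)) xor o           ≡⟨ cong (_xor o) (arc-next (out j) (in′ j) (prev k)) ⟩
      (arc (out j) (in′ j) (prev k) xor crossing (next (prev k))) xor o
        ≡⟨ cong (λ l → (arc (out j) (in′ j) (prev k) xor crossing l) xor o) (next-prev k) ⟩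
      (arc (out j) (in′ j) (prev k) xor crossing k) xor o ≡⟨ rearrange (arc (out j) (in′ j) (prev k)) (crossing k) o ⟩
      local j (prev k) xor crossing k                     ∎
      where
      open ≡-Reasoning
      o = arc (out j) (in′ j) (out j)
      rearrange : ∀ a b c → (a xor b) xor c ≡ (a xor c) xor b
      rearrange = solve 3 (λ a b c → (a :+ b) :+ c := (a :+ c) :+ b) refl

    crossing-EdgeOf : ∀ {j k} → EdgeOf (spoke (at j) k) → crossing k ≡ true
    crossing-EdgeOf {j} {k} E with EdgeOf-spoke E
    ... | inj₁ refl = cong₂ _xor_ (dec-true (k ≟ k) refl) (dec-false (k ≟ in′ j) (out≢in j))
    ... | inj₂ refl = cong₂ _xor_ (dec-false (k ≟ out j) (out≢in j ∘ sym)) (dec-true (k ≟ k) refl)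

    crossing-¬EdgeOf : ∀ {j k} → ¬ EdgeOf (spoke (at j) k) → crossing k ≡ false
    crossing-¬EdgeOf {j} {k} ¬E = cong₂ _xor_
      (dec-false (k ≟ out j) λ { refl → ¬E (out-EdgeOf j) })
      (dec-false (k ≟ in′ j) λ { refl → ¬E (in-EdgeOf j) })

    side : Fin len → Face → Bool
    side j f with any? (λ k → star (at j) k ≟ f)
    ... | yes (k , _) = turn j xor local j k
    -- Default for faces not at `at j`, which the conditions of `Cut` never inspect.
    ... | no  _       = false

    side-star : ∀ j k → side j (star (at j) k) ≡ turn j xor local j k
    side-star j k with any? (λ l → star (at j) l ≟ star (at j) k)
    ... | yes (l , eq) = cong (λ l → turn j xor local j l) (star-injective (at j) eq)
    ... | no  none     = ⊥-elim (none (k , refl))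

    side-across : ∀ {j e f g} → Across e f g → (at∈ : at j ∈ᵉ e) →
                  side j f xor side j g ≡ crossing (proj₁ (spoke-index at∈))
    side-across {j} ac at∈ with spoke-index at∈
    ... | k , refl = by-cases (across-spoke ac)
      where
      step : side j (star (at j) k) xor side j (star (at j) (prev k)) ≡ crossing k
      step = trans (cong₂ _xor_ (trans (side-star j k) (cong (turn j xor_) (local-prev j k))) (side-star j (prev k)))
                   (rearrange (turn j) (local j (prev k)) (crossing k))
        where
        rearrange : ∀ t l c → (t xor (l xor c)) xor (t xor l) ≡ c
        rearrange = solve 3 (λ t l c → (t :+ (l :+ c)) :+ (t :+ l) := c) refl
      by-cases : ∀ {f g} → (f ≡ star (at j) k × g ≡ star (at j) (prev k)) ⊎ (f ≡ star (at j) (prev k) × g ≡ star (at j) k) →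
                 side j f xor side j g ≡ crossing k
      by-cases (inj₁ (refl , refl)) = step
      by-cases (inj₂ (refl , refl)) = trans (xor-comm (side j (star (at j) (prev k))) _) step

    -- After the outgoing spoke `local` is false at `L`; after the incoming spoke at the next vertex
    -- it is true at `L′`. On an untwisted edge `L` is `R′`, and the colours agree. On a twisted
    -- edge `L` is `L′`, and the change of `turn` makes up for the discrepancy.
    side-along : ∀ j f → edge j ⊂ᶠ f → side j f ≡ side (next j) f
    side-along j f e⊂f = by-cases
      (face-of-spoke {at j} {out j} (subst (_⊂ᶠ f) (sym (proj₂ (out-spoke j))) e⊂f))
      (face-of-spoke {at (next j)} {in′ (next j)} (subst (_⊂ᶠ f) (sym (in-next j)) e⊂f))
      where
      L R L′ R′ : Face
      L  = star (at j) (out j)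
      R  = star (at j) (prev (out j))
      L′ = star (at (next j)) (in′ (next j))
      R′ = star (at (next j)) (prev (in′ (next j)))

      side-L : side j L ≡ turn j
      side-L = trans (side-star j (out j)) (trans (cong (turn j xor_) (local-out j)) (xor-identityʳ _))
      side-R : side j R ≡ turn j xor true
      side-R = trans (side-star j (prev (out j))) (cong (turn j xor_) (flip (local j (prev (out j)))
        (trans (cong (local j (prev (out j)) xor_) (sym (crossing-EdgeOf (out-EdgeOf j))))
               (trans (sym (local-prev j (out j))) (local-out j)))))
        where
        flip : ∀ b → b xor true ≡ false → b ≡ true
        flip true _ = refl
      side-L′ : side (next j) L′ ≡ turn (next j) xor true
      side-L′ = trans (side-star (next j) (in′ (next j))) (cong (turn (next j) xor_) (local-in (next j)))
      side-R′ : side (next j) R′ ≡ turn (next j)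
      side-R′ = trans (side-star (next j) (prev (in′ (next j)))) (trans (cong (turn (next j) xor_)
        (flip (local (next j) (prev (in′ (next j))))
        (trans (cong (local (next j) (prev (in′ (next j))) xor_) (sym (crossing-EdgeOf (in-EdgeOf (next j)))))
               (trans (sym (local-prev (next j) (in′ (next j)))) (local-in (next j)))))) (xor-identityʳ _))
        where
        flip : ∀ b → b xor true ≡ true → b ≡ false
        flip false _ = refl

      twisted : L ≡ L′ → turn (next j) ≡ turn j xor true
      twisted eq = trans (turn-next j) (cong (turn j xor_)
        (trans (twist-value (edge-joins j) (proj₂ (out-spoke j)) (in-next j)) (dec-true (L ≟ L′) eq)))
      straight : L ≢ L′ → turn (next j) ≡ turn j
      straight ne = trans (turn-next j) (trans (cong (turn j xor_)
        (trans (twist-value (edge-joins j) (proj₂ (out-spoke j)) (in-next j)) (dec-false (L ≟ L′) ne)))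
        (xor-identityʳ (turn j)))
      L⊂ : edge j ⊂ᶠ L
      L⊂ = subst (_⊂ᶠ L) (proj₂ (out-spoke j)) (spoke-first (at j) (out j))
      twice : ∀ b → (b xor true) xor true ≡ b
      twice false = refl
      twice true  = refl

      by-cases : f ≡ L ⊎ f ≡ R → f ≡ L′ ⊎ f ≡ R′ → side j f ≡ side (next j) f
      by-cases (inj₁ refl) (inj₁ eq) = trans side-L (sym (trans (cong (side (next j)) eq)
        (trans side-L′ (trans (cong (_xor true) (twisted eq)) (twice (turn j))))))
      by-cases (inj₁ refl) (inj₂ eq) = trans side-L (sym (trans (cong (side (next j)) eq)
        (trans side-R′ (straight λ eq′ → star≢prev _ (in′ (next j)) (trans (sym eq′) eq)))))
      by-cases (inj₂ refl) (inj₁ eq) = trans side-R (sym (trans (cong (side (next j)) eq)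
        (trans side-L′ (cong (_xor true) (straight λ eq′ → star≢prev _ (out j) (trans eq′ (sym eq)))))))
      by-cases (inj₂ refl) (inj₂ eq) with face-of-spoke {at (next j)} {in′ (next j)} (subst (_⊂ᶠ L) (sym (in-next j)) L⊂)
      ... | inj₁ L≡L′ = trans side-R (sym (trans (cong (side (next j)) eq) (trans side-R′ (twisted L≡L′))))
      ... | inj₂ L≡R′ = ⊥-elim (star≢prev _ (out j) (trans L≡R′ (sym eq)))

    two-sided : Cut K C
    two-sided = record
      { side     = λ j f → colour (side j f)
      ; opposite = λ j e f g ac at∈ E eq → true≢false (trans (sym (crossing-EdgeOf (E′ at∈ E)))
          (trans (sym (side-across ac at∈)) (trans (cong (_xor side j g) (colour-injective eq)) (xor-same (side j g)))))
      ; same     = λ j e f g ac at∈ ¬E → cong colour (xor-cancel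
          (trans (side-across ac at∈) (crossing-¬EdgeOf λ E → ¬E (subst EdgeOf (proj₂ (spoke-index at∈)) E))))
      ; along    = λ j e f e⊂f joins → cong colour
          (side-along j f (subst (_⊂ᶠ f) (simple _ _ _ _ joins (edge-joins j)) e⊂f)) }
      where
      E′ : ∀ {j e} (at∈ : at j ∈ᵉ e) → EdgeOf e → EdgeOf (spoke (at j) (proj₁ (spoke-index at∈)))
      E′ at∈ E = subst EdgeOf (sym (proj₂ (spoke-index at∈))) E

-- Cycles that are odd for a cocycle do not separate.

module NonSeparating (K : PolyhedralMap) (C : Cycle K) where
  open PolyhedralMap K
  open MapFacts K
  open AlongCycle K C
  open Cycle C renaming (length to len; injective to at-injective)

  Across? : ∀ e f g → Dec (Across e f g)
  Across? e f g = ¬? (f ≟ g) ×-dec e ⊂ᶠ? f ×-dec e ⊂ᶠ? g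

  Across-sym : ∀ {e f g} → Across e f g → Across e g f
  Across-sym (f≢g , e⊂f , e⊂g) = f≢g ∘ sym , e⊂g , e⊂f

  Crossable : Face → Face → Set
  Crossable f g = ∃[ e ] (Across e f g × ¬ EdgeOf e)

  Crossable? : ∀ f g → Dec (Crossable f g)
  Crossable? f g = any? λ e → Across? e f g ×-dec ¬? (EdgeOf? e)

  Crossable-sym : ∀ {f g} → Crossable f g → Crossable g f
  Crossable-sym (e , ac , ¬E) = e , Across-sym ac , ¬E

  -- Names for the two faces at an edge, taken from the star at its first end; they are not coherent
  -- from edge to edge.
  left right : Edge → Face
  left  e = star (proj₁ (ends e)) (proj₁ (spoke-index (proj₂ (ends e) , inj₁ refl)))
  right e = star (proj₁ (ends e)) (prev (proj₁ (spoke-index (proj₂ (ends e) , inj₁ refl))))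

  left-right : ∀ e → Across e (left e) (right e)
  left-right e with spoke-index {proj₁ (ends e)} {e} (proj₂ (ends e) , inj₁ refl)
  ... | k , eq = subst (λ e′ → Across e′ (star _ k) (star _ (prev k))) eq (spoke-across _ k)

  sides-of : ∀ {e f} → e ⊂ᶠ f → f ≡ left e ⊎ f ≡ right e
  sides-of {e} {f} e⊂f with spoke-index {proj₁ (ends e)} {e} (proj₂ (ends e) , inj₁ refl)
  ... | k , eq = face-of-spoke {proj₁ (ends e)} {k} (subst (_⊂ᶠ f) (sym eq) e⊂f)

  module _ {ψ : Edge → Bool} (cocycle : ∀ f → sum (λ e → does (e ⊂ᶠ? f) ∧ ψ e) ≡ false)
           (odd : sum (λ j → ψ (edge j)) ≡ true) where

    -- `D` is the indicator of a union of components of the complement of C. The edges with exactly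
    -- one side in `D` form the mod 2 boundary of `D`, contained in C, so they are none or all of
    -- the edges of C. All is impossible: ψ pairs to zero with a boundary but is odd on C.
    module Reached (D : Face → Bool) (closed : ∀ {f g} → Crossable f g → D f ≡ D g) where

      jump : Edge → Bool
      jump e = D (left e) xor D (right e)

      jump-across : ∀ {e f g} → Across e f g → D f xor D g ≡ jump e
      jump-across (f≢g , e⊂f , e⊂g) with sides-of e⊂f | sides-of e⊂g
      ... | inj₁ refl | inj₂ refl = refl
      ... | inj₂ refl | inj₁ refl = xor-comm (D _) (D _)
      ... | inj₁ refl | inj₁ refl = ⊥-elim (f≢g refl)
      ... | inj₂ refl | inj₂ refl = ⊥-elim (f≢g refl)

      jump-off : ∀ {e} → ¬ EdgeOf e → jump e ≡ false
      jump-off {e} ¬E = trans (cong (_xor D (right e)) (closed (e , left-right e , ¬E))) (xor-same (D (right e)))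

      -- The jumps around a vertex cancel, and only the two edges of C can contribute.
      jump-constant : ∀ j → jump (edge j) ≡ jump (edge (prev j))
      jump-constant j = xor-cancel (begin
        jump (edge j) xor jump (edge (prev j))
          ≡⟨ cong₂ (λ e e′ → jump e xor jump e′) (proj₂ (out-spoke j)) (proj₂ (in-spoke j)) ⟨
        jump (spoke u (out j)) xor jump (spoke u (in′ j))
          ≡⟨ sum-two (λ k → jump (spoke u k)) (out j) (in′ j) (out≢in j) others ⟨
        sum (λ k → jump (spoke u k))                     ≡⟨ sum-cong-≗ (λ k → sym (jump-across (spoke-across u k))) ⟩
        sum (λ k → D (star u k) xor D (star u (prev k))) ≡⟨ ∑-distrib-+ (λ k → D (star u k)) (λ k → D (star u (prev k))) ⟩
        sum (λ k → D (star u k)) xor sum (λ k → D (star u (prev k)))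
          ≡⟨ cong (sum (λ k → D (star u k)) xor_) (sym (sum-next (λ k → D (star u (prev k))))) ⟩
        sum (λ k → D (star u k)) xor sum (λ k → D (star u (prev (next k))))
          ≡⟨ cong (sum (λ k → D (star u k)) xor_) (sum-cong-≗ λ k → cong (λ l → D (star u l)) (prev-next k)) ⟩
        sum (λ k → D (star u k)) xor sum (λ k → D (star u k)) ≡⟨ xor-same (sum (λ k → D (star u k))) ⟩
        false                                            ∎)
        where
        open ≡-Reasoning
        u = at j
        others : ∀ k → k ≢ out j → k ≢ in′ j → jump (spoke u k) ≡ false
        others k k≢out k≢in = jump-off ([ k≢out , k≢in ]′ ∘ EdgeOf-spoke)

      jump-all : ∀ {i} j → jump (edge j) ≡ jump (edge i)
      jump-all {i} = next-induction (λ j → jump (edge j) ≡ jump (edge i)) {i} refl λ j eq →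
        trans (jump-constant (next j)) (trans (cong (jump ∘ edge) (prev-next j)) eq)

      -- Summing the cocycle over the faces in D leaves the edges with exactly one side in D.
      jump-orthogonal : sum (λ e → jump e ∧ ψ e) ≡ false
      jump-orthogonal = begin
        sum (λ e → jump e ∧ ψ e)                                       ≡⟨ sum-cong-≗ (sym ∘ one-edge) ⟩
        sum (λ e → sum (λ f → D f ∧ (does (e ⊂ᶠ? f) ∧ ψ e)))           ≡⟨ ∑-comm (λ e f → D f ∧ (does (e ⊂ᶠ? f) ∧ ψ e)) ⟩
        sum (λ f → sum (λ e → D f ∧ (does (e ⊂ᶠ? f) ∧ ψ e)))
          ≡⟨ sum-cong-≗ (λ f → sym (*-distribˡ-sum (D f) (λ e → does (e ⊂ᶠ? f) ∧ ψ e))) ⟩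
        sum (λ f → D f ∧ sum (λ e → does (e ⊂ᶠ? f) ∧ ψ e))
          ≡⟨ sum-false _ (λ f → trans (cong (D f ∧_) (cocycle f)) (∧-zeroʳ (D f))) ⟩
        false                                                          ∎
        where
        open ≡-Reasoning
        one-edge : ∀ e → sum (λ f → D f ∧ (does (e ⊂ᶠ? f) ∧ ψ e)) ≡ jump e ∧ ψ e
        one-edge e = begin
          sum t                                        ≡⟨ sum-two t (left e) (right e) (proj₁ (left-right e)) others ⟩
          t (left e) xor t (right e)
            ≡⟨ cong₂ (λ a b → (D (left e) ∧ (a ∧ ψ e)) xor (D (right e) ∧ (b ∧ ψ e)))
                     (dec-true (e ⊂ᶠ? left e) (proj₁ (proj₂ (left-right e))))
                     (dec-true (e ⊂ᶠ? right e) (proj₂ (proj₂ (left-right e)))) ⟩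
          (D (left e) ∧ ψ e) xor (D (right e) ∧ ψ e)   ≡⟨ ∧-distribʳ-xor (ψ e) (D (left e)) (D (right e)) ⟨
          jump e ∧ ψ e                                 ∎
          where
          t : Face → Bool
          t f = D f ∧ (does (e ⊂ᶠ? f) ∧ ψ e)
          others : ∀ f → f ≢ left e → f ≢ right e → t f ≡ false
          others f f≢l f≢r = trans (cong (λ b → D f ∧ (b ∧ ψ e)) (dec-false (e ⊂ᶠ? f) ([ f≢l , f≢r ]′ ∘ sides-of))) (∧-zeroʳ (D f))

      jump-not-true : ¬ (∀ j → jump (edge j) ≡ true)
      jump-not-true all = true≢false (trans (sym odd) (trans (sym total) jump-orthogonal))
        where
        open ≡-Reasoning
        on-C : ∀ e → jump e ∧ ψ e ≡ sum (λ j → does (edge j ≟ e) ∧ ψ e)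
        on-C e with EdgeOf? e
        ... | no ¬E = trans (cong (_∧ ψ e) (jump-off ¬E)) (sym (sum-false _ λ j →
          cong (_∧ ψ e) (dec-false (edge j ≟ e) λ { refl → ¬E (edge-EdgeOf j) })))
        ... | yes E with EdgeOf-edge E
        ...   | j , refl = trans (cong (_∧ ψ e) (all j)) (sym (trans
          (sum-one (λ i → does (edge i ≟ e) ∧ ψ e) j λ i i≢j →
            cong (_∧ ψ e) (dec-false (edge i ≟ e) (i≢j ∘ edge-injective)))
          (cong (_∧ ψ e) (dec-true (e ≟ e) refl))))
        total : sum (λ e → jump e ∧ ψ e) ≡ sum (λ j → ψ (edge j))
        total = begin
          sum (λ e → jump e ∧ ψ e)                            ≡⟨ sum-cong-≗ on-C ⟩
          sum (λ e → sum (λ j → does (edge j ≟ e) ∧ ψ e))     ≡⟨ ∑-comm (λ e j → does (edge j ≟ e) ∧ ψ e) ⟩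
          sum (λ j → sum (λ e → does (edge j ≟ e) ∧ ψ e))     ≡⟨ sum-cong-≗ (λ j → trans
            (sum-one (λ e → does (edge j ≟ e) ∧ ψ e) (edge j) λ e e≢ → cong (_∧ ψ e) (dec-false (edge j ≟ e) (e≢ ∘ sym)))
            (cong (_∧ ψ (edge j)) (dec-true (edge j ≟ edge j) refl))) ⟩
          sum (λ j → ψ (edge j))                              ∎

      constant : ∀ {e f g} → Across e f g → D f ≡ D g
      constant {e} ac = xor-cancel (trans (jump-across ac) off)
        where
        zero-on-C : ∀ j → jump (edge j) ≡ false
        zero-on-C j with jump (edge j) in eq
        ... | false = refl
        ... | true  = ⊥-elim (jump-not-true λ i → trans (jump-all {j} i) eq)
        off : jump e ≡ false
        off with EdgeOf? e
        ... | no ¬E = jump-off ¬E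
        ... | yes E = subst (λ e → jump e ≡ false) (proj₂ (EdgeOf-edge E)) (zero-on-C _)

    -- The faces reached from `f` without crossing C form a set to which `constant` applies, so
    -- crossing C does not leave it either.
    crossable-connected : ∀ f g → Star Crossable f g
    crossable-connected f g with reachable Crossable? f
    ... | D , f∈ , reach , closed = reach (all-faces (_∈ D) (λ {_} {f} {g} ac f∈D → member ac f∈D) f∈ g)
      where
      does≡⇒ : ∀ {X Y : Set} (x? : Dec X) (y? : Dec Y) → does x? ≡ does y? → X → Y
      does≡⇒ x? (yes y) _  _ = y
      does≡⇒ x? (no ¬y) eq x with trans (sym (dec-true x? x)) eq
      ... | ()
      closed-≡ : ∀ {f g} → Crossable f g → does (f ∈? D) ≡ does (g ∈? D)
      closed-≡ {f} {g} c = does-⇔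
        (mk⇔ (λ f∈D → closed f∈D c) (λ g∈D → closed g∈D (Crossable-sym c))) (f ∈? D) (g ∈? D)
      open Reached (λ f → does (f ∈? D)) closed-≡
      member : ∀ {e f g} → Across e f g → f ∈ D → g ∈ D
      member {e} {f} {g} ac = does≡⇒ (f ∈? D) (g ∈? D) (constant ac)

    not-separating : ¬ Separates K C
    not-separating (f , g , ¬path) = ¬path (crossable-connected f g)

    -- The faces of a disk could be left only across C. Since all faces are connected off C, the
    -- disk has all faces or none, yet an edge of C has one side in and one side out.
    not-contractible : ¬ BoundsDisk K C
    not-contractible disk = crosses
      (Equivalence.to (boundary-is-C (edge i) (left (edge i)) (right (edge i)) (left-right (edge i))) (edge-EdgeOf i))
      where
      open BoundsDisk disk
      i : Fin len
      i = first length≥3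
      stay : ∀ {f g} → Star Crossable f g → f ∈ D → g ∈ D
      stay ε f∈ = f∈
      stay ((e , ac , ¬E) ◅ path) f∈ = stay path
        (decidable-stable (_ ∈? D) λ g∉ → ¬E (Equivalence.from (boundary-is-C e _ _ ac) (inj₁ (f∈ , g∉))))
      crosses : ∀ {f g} → ¬ ((f ∈ D × g ∉ D) ⊎ (f ∉ D × g ∈ D))
      crosses (inj₁ (f∈ , g∉)) = g∉ (stay (crossable-connected _ _) f∈)
      crosses (inj₂ (f∉ , g∈)) = f∉ (stay (crossable-connected _ _) g∈)

    non-trivial : NonTrivial K C
    non-trivial = not-contractible , λ (_ , sep) → not-separating sep

-- Choice of the cocycle and of the cycle C.

module Homology (K : PolyhedralMap) (χ≡-2 : PolyhedralMap.χ K ≡ ℤ.- (+ 2)) where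
  open PolyhedralMap K
  open MapFacts K
  open Orientation K

  edge-count : nE ≡ (nV + nF) + 2
  edge-count = ℤ.+-injective (begin
    + nE                                                      ≡⟨ isolate (+ nV) (+ nE) (+ nF) ⟩
    (+ nV ℤ.+ + nF) ℤ.- ((+ nV ℤ.- + nE) ℤ.+ + nF)            ≡⟨ cong (λ x → (+ nV ℤ.+ + nF) ℤ.- x) χ≡-2 ⟩
    (+ nV ℤ.+ + nF) ℤ.+ + 2                                   ∎)
    where
    open ≡-Reasoning
    isolate : ∀ v e f → e ≡ (v ℤ.+ f) ℤ.- ((v ℤ.- e) ℤ.+ f)
    isolate = solve-∀

  -- The right side exceeds the left by exactly one: `nF` cocycle conditions, `nV` bits for
  -- potentials, one bit for `twist`, against `nV + nF + 2` edges.
  enough-edges : nF + suc nV < nE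
  enough-edges = subst (nF + suc nV <_) (sym edge-count) (≡⇒≤ (begin
    suc (nF + suc nV)   ≡⟨ cong suc (+-suc nF nV) ⟩
    2 + (nF + nV)       ≡⟨ cong (λ k → 2 + k) (+-comm nF nV) ⟩
    2 + (nV + nF)       ≡⟨ +-comm 2 (nV + nF) ⟩
    (nV + nF) + 2       ∎))
    where
    open ≡-Reasoning
    ≡⇒≤ : ∀ {m n} → m ≡ n → m ≤ n
    ≡⇒≤ refl = ≤-refl

  -- The functions that ψ must avoid: the head of the vector is the coefficient of `twist`, the tail
  -- a potential.
  gauge : Vec Bool (suc nV) → Edge → Bool
  gauge (b ∷ c) e = let u , v = ends e in (Vec.lookup c u xor Vec.lookup c v) xor (b ∧ twist u v)

  gauge-additive : Additive gauge
  gauge-additive (b ∷ c) (b′ ∷ c′) e = let u , v = ends e in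
    trans (cong₂ (λ s t → (s xor t) xor ((b xor b′) ∧ twist u v)) (lookup-zipWith _xor_ u c c′) (lookup-zipWith _xor_ v c c′))
          (rearrange (Vec.lookup c u) (Vec.lookup c′ u) (Vec.lookup c v) (Vec.lookup c′ v) b b′ (twist u v))
    where
    rearrange : ∀ s s′ t t′ b b′ w →
      ((s xor s′) xor (t xor t′)) xor ((b xor b′) ∧ w) ≡ ((s xor t) xor (b ∧ w)) xor ((s′ xor t′) xor (b′ ∧ w))
    rearrange s s′ t t′ b b′ w = trans
      (cong₂ _xor_ (interchange s s′ t t′) (∧-distribʳ-xor w b b′))
      (interchange (s xor t) (s′ xor t′) (b ∧ w) (b′ ∧ w))
      where
      interchange : ∀ a b c d → (a xor b) xor (c xor d) ≡ (a xor c) xor (b xor d)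
      interchange = solve 4 (λ a b c d → (a :+ b) :+ (c :+ d) := (a :+ c) :+ (b :+ d)) refl

  origin : Vertex
  origin = fromℕ< nonempty

  some-edge : Edge
  some-edge = spoke origin (first (degree≥3 origin))

  abstract
    pivoting : Σ (Fin (suc nV) → Edge) λ pos → ∀ x → (∀ i → gauge x (pos i) ≡ false) → ∀ e → gauge x e ≡ false
    pivoting = pivots some-edge gauge gauge-additive

  pivot : Fin (suc nV) → Edge
  pivot = proj₁ pivoting

  -- The first block says that ψ is a cocycle. The second makes it vanish at the pivots, where only
  -- the zero gauge function vanishes; hence a nonzero solution is no gauge function.
  conditions : (Edge → Bool) → Fin (nF + suc nV) → Bool
  conditions ψ i = [ (λ f → sum (λ e → does (e ⊂ᶠ? f) ∧ ψ e)) , ψ ∘ pivot ]′ (splitAt nF i)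

  conditions-additive : ∀ ψ φ i → conditions (λ e → ψ e xor φ e) i ≡ conditions ψ i xor conditions φ i
  conditions-additive ψ φ i with splitAt nF i
  ... | inj₁ f = trans (sum-cong-≗ λ e → ∧-distribˡ-xor (does (e ⊂ᶠ? f)) (ψ e) (φ e))
                       (∑-distrib-+ (λ e → does (e ⊂ᶠ? f) ∧ ψ e) (λ e → does (e ⊂ᶠ? f) ∧ φ e))
  ... | inj₂ j = refl

  abstract
    solution : ∃[ ψ ] ((∀ i → conditions ψ i ≡ false) × ∃[ e ] ψ e ≡ true)
    solution = kernel-nonzero enough-edges conditions conditions-additive

  ψ : Edge → Bool
  ψ = proj₁ solution

  cocycle : ∀ f → sum (λ e → does (e ⊂ᶠ? f) ∧ ψ e) ≡ false
  cocycle f = trans (cong [ _ , _ ]′ (sym (splitAt-↑ˡ nF f (suc nV)))) (proj₁ (proj₂ solution) (f ↑ˡ suc nV))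

  ψ-pivot : ∀ i → ψ (pivot i) ≡ false
  ψ-pivot i = trans (cong [ _ , _ ]′ (sym (splitAt-↑ʳ nF (suc nV) i))) (proj₁ (proj₂ solution) (nF ↑ʳ i))

  not-gauge : ∀ x → ¬ (∀ e → ψ e ≡ gauge x e)
  not-gauge x eq with proj₂ (proj₂ solution)
  ... | e , ψe≡1 with trans (sym ψe≡1) (trans (eq e)
        (proj₂ pivoting x (λ i → trans (sym (eq (pivot i))) (ψ-pivot i)) e))
  ... | ()

  no-potential : ∀ {b} → ¬ Potential (λ u v → onPairs ψ u v xor (b ∧ twist u v))
  no-potential {b} (c , δ) = not-gauge (b ∷ Vec.tabulate c) λ e → let u , v = ends e in
    trans (solve-for (ψ e) (b ∧ twist u v) (c u xor c v)
             (trans (cong (_xor (b ∧ twist u v)) (sym (onPairs-edge ψ (inj₁ refl)))) (δ u v (e , inj₁ refl))))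
          (sym (cong₂ (λ s t → (s xor t) xor (b ∧ twist u v)) (lookup∘tabulate c u) (lookup∘tabulate c v)))
    where
    solve-for : ∀ x y z → x xor y ≡ z → x ≡ z xor y
    solve-for x y _ refl = sym (trans (xor-assoc x y y) (trans (cong (x xor_) (xor-same y)) (xor-identityʳ x)))

  abstract
    simple-cycle : SimpleCycle twist (onPairs ψ) false
    simple-cycle = [ id , ⊥-elim ∘ no-potential ∘ proj₂ ]′
      (balanced-cycle supply twist-sym (onPairs-sym ψ)
        (_ , proj₂ (spoke-incident origin (first (degree≥3 origin)))))

  C : Cycle K
  C = toCycle (onPairs-sym ψ) simple-cycle

  odd-crossing : sum (λ j → ψ (AlongCycle.edge K C j)) ≡ true
  odd-crossing = trans (sum-cong-≗ λ j → sym (onPairs-edge ψ (AlongCycle.edge-joins K C j)))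
    (trans (toCycle-sum (onPairs-sym ψ) simple-cycle (onPairs ψ)) (SimpleCycle.weight-ψ simple-cycle))

  cut : Cut K C
  cut = TwoSided.two-sided K C
    (trans (toCycle-sum (onPairs-sym ψ) simple-cycle twist) (SimpleCycle.weight-w simple-cycle))

  C-connected : ∀ f g → Star (NonSeparating.Crossable K C) f g
  C-connected = NonSeparating.crossable-connected K C cocycle odd-crossing

  C-non-trivial : NonTrivial K C
  C-non-trivial = NonSeparating.non-trivial K C cocycle odd-crossing

-- The cyclic cover as a polyhedral map.

-- The cover is determined by `s`, which tells whether a face on sheet i meets a vertex at level i
-- or at level i + 1. `compatible` makes the lifts of an edge well defined: off C two faces at it
-- agree at both ends, on C each is constant along it. `chain` connects a sheet and `climb` leads to
-- the next one.
module Cover (K : PolyhedralMap) (n : ℕ)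
  (s : PolyhedralMap.Face K → PolyhedralMap.Vertex K → Bool)
  (compatible : ∀ {e u v f g} → PolyhedralMap.Joins K e u v → PolyhedralMap._⊂ᶠ_ K e f → PolyhedralMap._⊂ᶠ_ K e g →
                (s f u ≡ s g u × s f v ≡ s g v) ⊎ (s f u ≡ s f v × s g u ≡ s g v))
  (chain : ∀ f g → Star (λ f g → ∃[ u ] (PolyhedralMap._∈ᶠ_ K u f × PolyhedralMap._∈ᶠ_ K u g × s f u ≡ s g u)) f g)
  (climb : ∃[ u ] ∃[ f ] ∃[ g ] (PolyhedralMap._∈ᶠ_ K u f × PolyhedralMap._∈ᶠ_ K u g × s f u ≡ false × s g u ≡ true))
  where
  open PolyhedralMap K
  open MapFacts K using (Joins-sym; Joins-∈ᵉ; Joins-ends; ⊂ᶠ⇒∈ᶠ; ∈ᶠ-star; first)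

  m : ℕ
  m = suc n

  level : ∀ {k} → Fin (m * k) → Fin m
  level {k} x = proj₁ (remQuot {m} k x)

  base : ∀ {k} → Fin (m * k) → Fin k
  base {k} x = proj₂ (remQuot {m} k x)

  level-combine : ∀ {k} i (x : Fin k) → level (combine i x) ≡ i
  level-combine i x = cong proj₁ (remQuot-combine i x)

  base-combine : ∀ {k} (i : Fin m) (x : Fin k) → base (combine i x) ≡ x
  base-combine i x = cong proj₂ (remQuot-combine i x)

  ext : ∀ {k} {x y : Fin (m * k)} → level x ≡ level y → base x ≡ base y → x ≡ y
  ext {k} {x} {y} eq eq′ =
    trans (sym (combine-remQuot {m} k x)) (trans (cong₂ combine eq eq′) (combine-remQuot {m} k y))

  shift unshift : Bool → Fin m → Fin m
  shift false = id
  shift true  = next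
  unshift false = id
  unshift true  = prev

  shift-unshift : ∀ b i → shift b (unshift b i) ≡ i
  shift-unshift false i = refl
  shift-unshift true  i = next-prev i

  unshift-shift : ∀ b i → unshift b (shift b i) ≡ i
  unshift-shift false i = refl
  unshift-shift true  i = prev-next i

  shift-injective : ∀ b {i j} → shift b i ≡ shift b j → i ≡ j
  shift-injective b {i} {j} eq = trans (sym (unshift-shift b i)) (trans (cong (unshift b) eq) (unshift-shift b j))

  -- The level of the vertex v in the copy of the face f on sheet i.
  height : Face → Vertex → Fin m → Fin m
  height f v = shift (s f v)

  place : Face → Fin m → Vertex → Fin (m * nV)
  place f i v = combine (height f v i) v

  -- An edge on sheet i is the edge of the copy on sheet i of this face.
  host : Edge → Face
  host e = proj₁ (edge-in-face e)

  host-⊃ : ∀ e → e ⊂ᶠ host e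
  host-⊃ e = proj₂ (edge-in-face e)

  cover : CellComplex
  cover = record
    { nV = m * nV ; nE = m * nE ; nF = m * nF
    ; ends     = λ E → place (host (base E)) (level E) (proj₁ (ends (base E))) ,
                       place (host (base E)) (level E) (proj₂ (ends (base E)))
    ; size     = λ F → size (base F)
    ; boundary = λ F k → place (base F) (level F) (boundary (base F) k) }

  module L = CellComplex cover

  -- Faces lifted over a common edge that meet above one end also meet above the other. Either the
  -- shifts agree and the sheets coincide, or the level is constant along the edge in both faces.
  heights-agree : ∀ {e u v f g i j} → Joins e u v → e ⊂ᶠ f → e ⊂ᶠ g →
                  height f u i ≡ height g u j → height f v i ≡ height g v j
  heights-agree {u = u} {v} {f} {g} {i} {j} uv e⊂f e⊂g eq with compatible uv e⊂f e⊂g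
  ... | inj₁ (su , sv) = trans (cong (height f v) (shift-injective (s f u)
          (trans eq (cong (λ b → shift b j) (sym su))))) (cong (λ b → shift b j) sv)
  ... | inj₂ (sf , sg) = trans (cong (λ b → shift b i) (sym sf)) (trans eq (cong (λ b → shift b j) sg))

  agree-at : ∀ {e f g i j u w} → u ∈ᵉ e → e ⊂ᶠ f → e ⊂ᶠ g → height f u i ≡ height g u j →
             w ∈ᵉ e → height f w i ≡ height g w j
  agree-at (v , uv) e⊂f e⊂g eq w∈e with Joins-∈ᵉ uv w∈e
  ... | inj₁ refl = eq
  ... | inj₂ refl = heights-agree uv e⊂f e⊂g eq

  Joins⁺ : ∀ E {u v} → Joins (base E) u v →
           L.Joins E (place (host (base E)) (level E) u) (place (host (base E)) (level E) v)
  Joins⁺ E (inj₁ eq) = inj₁ (cong (λ (u , v) → place (host (base E)) (level E) u , place (host (base E)) (level E) v) eq)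
  Joins⁺ E (inj₂ eq) = inj₂ (cong (λ (u , v) → place (host (base E)) (level E) u , place (host (base E)) (level E) v) eq)

  Sits : Fin (m * nE) → Fin (m * nV) → Set
  Sits E U = level U ≡ height (host (base E)) (base U) (level E)

  place-sits : ∀ E {u U} → place (host (base E)) (level E) u ≡ U → u ≡ base U × Sits E U
  place-sits E {u} refl = sym (base-combine (height _ u _) u) ,
    trans (level-combine (height _ u _) u)
          (cong (λ v → height (host (base E)) v (level E)) (sym (base-combine (height (host (base E)) u (level E)) u)))

  Joins⁻ : ∀ {E U V} → L.Joins E U V → Joins (base E) (base U) (base V) × Sits E U × Sits E V
  Joins⁻ {E} (inj₁ refl) with place-sits E {proj₁ (ends (base E))} refl | place-sits E {proj₂ (ends (base E))} refl
  ... | bu , su | bv , sv = inj₁ (cong₂ _,_ bu bv) , su , sv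
  Joins⁻ {E} (inj₂ refl) with place-sits E {proj₁ (ends (base E))} refl | place-sits E {proj₂ (ends (base E))} refl
  ... | bv , sv | bu , su = inj₂ (cong₂ _,_ bv bu) , su , sv

  sits-place : ∀ E U → Sits E U → place (host (base E)) (level E) (base U) ≡ U
  sits-place E U su = ext (trans (level-combine h (base U)) (sym su)) (base-combine h (base U))
    where h = height (host (base E)) (base U) (level E)

  -- The lift of the edge e having its endpoint u on level i.
  over : Edge → Vertex → Fin m → Fin (m * nE)
  over e u i = combine (unshift (s (host e) u) i) e

  over-base : ∀ e u i → base (over e u i) ≡ e
  over-base e u i = base-combine (unshift (s (host e) u) i) e

  over-height : ∀ e u i → height (host (base (over e u i))) u (level (over e u i)) ≡ i
  over-height e u i = trans
    (cong₂ (λ e j → height (host e) u j) (over-base e u i) (level-combine (unshift (s (host e) u) i) e))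
    (shift-unshift (s (host e) u) i)

  ∈ᶠ⁻ : ∀ {U F} → U L.∈ᶠ F → base U ∈ᶠ base F × level U ≡ height (base F) (base U) (level F)
  ∈ᶠ⁻ {F = F} (k , refl) = (k , sym b≡) ,
    trans (level-combine (height (base F) u (level F)) u) (cong (λ v → height (base F) v (level F)) (sym b≡))
    where
    u = boundary (base F) k
    b≡ = base-combine (height (base F) u (level F)) u

  ∈ᶠ⁺ : ∀ {U F} → base U ∈ᶠ base F → level U ≡ height (base F) (base U) (level F) → U L.∈ᶠ F
  ∈ᶠ⁺ {U} {F} (k , eq) lv = k , trans (cong (place (base F) (level F)) eq)
    (ext (trans (level-combine (height (base F) (base U) (level F)) (base U)) (sym lv))
         (base-combine (height (base F) (base U) (level F)) (base U)))

  -- Matching levels at one end suffice, since `agree-at` carries them to the other.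
  ⊂ᶠ⁺ : ∀ {E F u} → (e⊂f : base E ⊂ᶠ base F) → u ∈ᵉ base E →
        height (host (base E)) u (level E) ≡ height (base F) u (level F) →
        L.Joins E (L.boundary F (proj₁ e⊂f)) (L.boundary F (next (proj₁ e⊂f)))
  ⊂ᶠ⁺ {E} {F} e⊂f@(k , j) u∈e eq = subst₂ (λ i i′ → L.Joins E (combine i x) (combine i′ y))
    (agree-at u∈e (host-⊃ (base E)) e⊂f eq (y , j)) (agree-at u∈e (host-⊃ (base E)) e⊂f eq (x , Joins-sym j))
    (Joins⁺ E j)
    where
    x y : Vertex
    x = boundary (base F) k
    y = boundary (base F) (next k)

  over-⊂ᶠ : ∀ {e u i F} → (e⊂f : e ⊂ᶠ base F) → u ∈ᵉ e → i ≡ height (base F) u (level F) →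
            L.Joins (over e u i) (L.boundary F (proj₁ e⊂f)) (L.boundary F (next (proj₁ e⊂f)))
  over-⊂ᶠ {e} {u} {i} {F} (k , j) u∈e eq = ⊂ᶠ⁺ {over e u i} {F}
    (k , subst (λ e → Joins e _ _) (sym (over-base e u i)) j) (subst (u ∈ᵉ_) (sym (over-base e u i)) u∈e)
    (trans (over-height e u i) eq)

  boundary-edgesᴸ : ∀ F k → L.Adjacent (L.boundary F k) (L.boundary F (next k))
  boundary-edgesᴸ F k with boundary-edges (base F) k
  ... | e , j = over e (boundary (base F) k) (height (base F) (boundary (base F) k) (level F)) ,
                over-⊂ᶠ {F = F} (k , j) (_ , j) refl

  -- Each face at `base U` is taken on the unique sheet whose copy passes through `U`.
  starᴸ : (U : L.Vertex) → Fin (degree (base U)) → L.Face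
  starᴸ U k = combine (unshift (s (star (base U) k) (base U)) (level U)) (star (base U) k)

  spokeᴸ : (U : L.Vertex) → Fin (degree (base U)) → L.Edge
  spokeᴸ U k = over (spoke (base U) k) (base U) (level U)

  starᴸ-base : ∀ U k → base (starᴸ U k) ≡ star (base U) k
  starᴸ-base U k = base-combine (unshift (s (star (base U) k) (base U)) (level U)) _

  starᴸ-height : ∀ U k → level U ≡ height (base (starᴸ U k)) (base U) (level (starᴸ U k))
  starᴸ-height U k = sym (trans
    (cong₂ (λ f j → height f (base U) j) (starᴸ-base U k)
           (level-combine (unshift (s (star (base U) k) (base U)) (level U)) (star (base U) k)))
    (shift-unshift (s (star (base U) k) (base U)) (level U)))

  spoke-⊂-star : ∀ U k l → spoke (base U) k ⊂ᶠ star (base U) l → spokeᴸ U k L.⊂ᶠ starᴸ U l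
  spoke-⊂-star U k l e⊂f = _ , over-⊂ᶠ {F = starᴸ U l}
    (subst (spoke (base U) k ⊂ᶠ_) (sym (starᴸ-base U l)) e⊂f) (spoke-incident (base U) k) (starᴸ-height U l)

  star-completeᴸ : ∀ U F → U L.∈ᶠ F → ∃[ k ] starᴸ U k ≡ F
  star-completeᴸ U F U∈F with ∈ᶠ⁻ {U} {F} U∈F
  ... | u∈f , lv with star-complete (base U) (base F) u∈f
  ... | k , eq = k , ext
    (trans (level-combine (unshift (s (star (base U) k) (base U)) (level U)) (star (base U) k))
      (trans (cong (λ f → unshift (s f (base U)) (level U)) eq)
        (trans (cong (unshift (s (base F) (base U))) lv) (unshift-shift (s (base F) (base U)) (level F)))))
    (trans (starᴸ-base U k) eq)

  over-∈ᵉ : ∀ {e u i W} → base W ∈ᵉ e → level W ≡ height (host (base (over e u i))) (base W) (level (over e u i)) →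
            W L.∈ᵉ over e u i
  over-∈ᵉ {e} {u} {i} {W} (v , j) lv = _ , subst (λ V → L.Joins (over e u i) V _) (sits-place (over e u i) W lv)
    (Joins⁺ (over e u i) (subst (λ e → Joins e _ v) (sym (over-base e u i)) j))

  simpleᴸ : ∀ E E′ U V → L.Joins E U V → L.Joins E′ U V → E ≡ E′
  simpleᴸ E E′ U V J J′ with Joins⁻ {E} J | Joins⁻ {E′} J′
  ... | j , su , _ | j′ , su′ , _ = ext
    (shift-injective (s (host (base E)) (base U)) (trans (sym su) (trans su′ (cong (λ e → height (host e) (base U) (level E′)) (sym e≡)))))
    e≡
    where e≡ = simple _ _ _ _ j j′

  Connected : L.Vertex → L.Vertex → Set
  Connected = Star L.Adjacent

  record Reaches (U : L.Vertex) (i : Fin m) (f : Face) : Set where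
    constructor reaches
    field reach : ∀ W → W L.∈ᶠ combine i f → Connected U W

  open Reaches

  reach-face : ∀ {U V i f} → Connected U V → V L.∈ᶠ combine i f → Reaches U i f
  reach-face {U} {V} {i} {f} path (k , eq) = reaches λ { W (l , refl) →
    next-induction (λ l → Connected U (L.boundary F l)) {k} (subst (Connected U) (sym eq) path)
      (λ l path → path ◅◅ boundary-edgesᴸ F l ◅ ε) l }
    where F = combine i f

  place-∈ᶠ : ∀ {f u} i → u ∈ᶠ f → place f i u L.∈ᶠ combine i f
  place-∈ᶠ {f} {u} i u∈f = ∈ᶠ⁺ {place f i u} {combine i f}
    (subst₂ _∈ᶠ_ (sym (base-combine (height f u i) u)) (sym (base-combine i f)) u∈f)
    (trans (level-combine (height f u i) u)
      (trans (cong₂ (λ f v → height f v i) (sym (base-combine i f)) (sym (base-combine (height f u i) u)))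
             (cong (height (base (combine i f)) (base (place f i u))) (sym (level-combine i f)))))

  meet : ∀ {U f g u i j} → u ∈ᶠ f → u ∈ᶠ g → height f u i ≡ height g u j →
         Reaches U i f → Reaches U j g
  meet {U} {f} {g} {u} {i} {j} u∈f u∈g eq R = reach-face (reach R (place f i u) (place-∈ᶠ i u∈f))
    (subst (L._∈ᶠ combine j g) (cong (λ i → combine i u) (sym eq)) (place-∈ᶠ j u∈g))

  along-sheet : ∀ {U i f} g → Reaches U i f → Reaches U i g
  along-sheet {U} {i} {f} g = go (chain f g)
    where
    go : ∀ {f g} → Star (λ f g → ∃[ u ] (u ∈ᶠ f × u ∈ᶠ g × s f u ≡ s g u)) f g →
         Reaches U i f → Reaches U i g
    go ε R = R
    go ((u , u∈f , u∈g , eq) ◅ path) R = go path (meet u∈f u∈g (cong (λ b → shift b i) eq) R)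

  -- At the vertex given by `climb`, the face `h` on sheet `i` and the face `g` on sheet `next i`
  -- both sit at level `next i`.
  up : ∀ {U i f} → Reaches U i f → Reaches U (next i) f
  up {U} {i} {f} R = let u , g , h , u∈g , u∈h , g≡ , h≡ = climb in
    along-sheet f (meet u∈h u∈g (trans (cong (λ b → shift b i) h≡) (cong (λ b → shift b (next i)) (sym g≡)))
      (along-sheet h R))

  connectedᴸ : ∀ U V → Connected U V
  connectedᴸ U V = toFace (starᴸ V (first (degree≥3 (base V)))) V (U∈star V)
    where
    U∈star : ∀ U → U L.∈ᶠ starᴸ U (first (degree≥3 (base U)))
    U∈star U = ∈ᶠ⁺ {U} {starᴸ U k}
      (subst (base U ∈ᶠ_) (sym (starᴸ-base U k)) (∈ᶠ-star (base U) k)) (starᴸ-height U k)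
      where k = first (degree≥3 (base U))
    f₀ = star (base U) (first (degree≥3 (base U)))
    everywhere : ∀ i f → Reaches U i f
    everywhere i f = along-sheet f (next-induction (λ i → Reaches U i f₀)
      {unshift (s f₀ (base U)) (level U)} (reach-face ε (U∈star U)) (λ _ → up) i)
    toFace : ∀ F W → W L.∈ᶠ F → Connected U W
    toFace F = subst (λ F → ∀ W → W L.∈ᶠ F → Connected U W) (combine-remQuot {m} nF F)
      (reach (everywhere (level F) (base F)))

  -- Distinct lifts of one face share no vertex, because the level of a shared vertex determines the
  -- sheet. So `F` and `G` lie over distinct faces, and their common vertex or edge lifts through
  -- `U`; levels elsewhere on that edge are forced by `agree-at`.
  polyhedralᴸ : ∀ F G → F ≢ G → ∀ U → U L.∈ᶠ F → U L.∈ᶠ G →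
    (∀ W → W L.∈ᶠ F → W L.∈ᶠ G → W ≡ U) ⊎
    (∃[ E ] (E L.⊂ᶠ F × E L.⊂ᶠ G × (∀ W → W L.∈ᶠ F → W L.∈ᶠ G → W L.∈ᵉ E)))
  polyhedralᴸ F G F≢G U U∈F U∈G with ∈ᶠ⁻ {U} {F} U∈F | ∈ᶠ⁻ {U} {G} U∈G
  ... | u∈f , lf | u∈g , lg with polyhedral (base F) (base G) f≢g (base U) u∈f u∈g
    where
    f≢g : base F ≢ base G
    f≢g eq = F≢G (ext (shift-injective (s (base F) (base U))
      (trans (sym lf) (trans lg (cong (λ f → height f (base U) (level G)) (sym eq))))) eq)
  ... | inj₁ only = inj₁ λ W W∈F W∈G →
    let w∈f , lw = ∈ᶠ⁻ {W} {F} W∈F ; w≡u = only (base W) w∈f (proj₁ (∈ᶠ⁻ {W} {G} W∈G))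
    in ext (trans lw (trans (cong (λ v → height (base F) v (level F)) w≡u) (sym lf))) w≡u
  ... | inj₂ (e , e⊂f , e⊂g , common) = inj₂ (over e (base U) (level U) , (_ , over-⊂ᶠ {F = F} e⊂f u∈e lf) ,
    (_ , over-⊂ᶠ {F = G} e⊂g u∈e lg) , λ W W∈F W∈G →
      let w∈f , lw = ∈ᶠ⁻ {W} {F} W∈F ; w∈e = common (base W) w∈f (proj₁ (∈ᶠ⁻ {W} {G} W∈G))
      in over-∈ᵉ {W = W} w∈e (trans lw (sym (agree-at u∈e′ (host-⊃ _) (e⊂ e⊂f) (trans (over-height e (base U) (level U)) lf) (∈e w∈e)))))
    where
    u∈e = common (base U) u∈f u∈g
    E≡ = sym (over-base e (base U) (level U))
    ∈e : ∀ {w} → w ∈ᵉ e → w ∈ᵉ base (over e (base U) (level U))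
    ∈e {w} = subst (w ∈ᵉ_) E≡
    u∈e′ = ∈e u∈e
    e⊂ : ∀ {f} → e ⊂ᶠ f → base (over e (base U) (level U)) ⊂ᶠ f
    e⊂ {f} = subst (_⊂ᶠ f) E≡

  Kᵐ : PolyhedralMap
  Kᵐ = record
    { complex            = cover
    ; loopless           = λ E U J → loopless (base E) (base U) (proj₁ (Joins⁻ {E} J))
    ; simple             = simpleᴸ
    ; size≥3             = λ F → size≥3 (base F)
    ; boundary-injective = λ F {k} {l} eq → boundary-injective (base F)
        (trans (sym (base-combine (height (base F) (boundary (base F) k) (level F)) _))
               (trans (cong base eq) (base-combine (height (base F) (boundary (base F) l) (level F)) _)))
    ; boundary-edges     = boundary-edgesᴸ
    ; edge-in-face       = λ E → combine (level E) (host (base E)) , _ , ⊂ᶠ⁺ {E} {combine (level E) (host (base E))}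
        (subst (base E ⊂ᶠ_) (sym (base-combine (level E) (host (base E)))) (host-⊃ (base E)))
        (_ , inj₁ refl)
        (sym (cong₂ (λ f i → height f (proj₁ (ends (base E))) i)
                    (base-combine (level E) (host (base E))) (level-combine (level E) (host (base E)))))
    ; degree             = λ U → degree (base U)
    ; degree≥3           = λ U → degree≥3 (base U)
    ; star               = starᴸ
    ; spoke              = spokeᴸ
    ; star-injective     = λ U {k} {l} eq → star-injective (base U)
        (trans (sym (starᴸ-base U k)) (trans (cong base eq) (starᴸ-base U l)))
    ; star-complete      = star-completeᴸ
    ; spoke-injective    = λ U {k} {l} eq → spoke-injective (base U)
        (trans (sym (over-base _ (base U) (level U))) (trans (cong base eq) (over-base _ (base U) (level U))))
    ; spoke-incident     = λ U k → over-∈ᵉ {W = U} (spoke-incident (base U) k) (sym (over-height _ (base U) (level U)))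
    ; spoke-first        = λ U k → spoke-⊂-star U k k (spoke-first (base U) k)
    ; spoke-second       = λ U k → spoke-⊂-star U (next k) k (spoke-second (base U) k)
    ; nonempty           = <-≤-trans nonempty (m≤m+n nV (n * nV))
    ; connected          = connectedᴸ
    ; polyhedral         = polyhedralᴸ }

  same-type : ∀ X → IsSemiEquivelar X K → IsSemiEquivelar X Kᵐ
  same-type X semi U = subst (_≈ᶜ VertexType.sequence X)
    (sym (tabulate-cong λ k → cong size (starᴸ-base U k))) (semi (base U))

  χ-cover : PolyhedralMap.χ Kᵐ ≡ + m ℤ.* χ
  χ-cover = begin
    (+ (m * nV) ℤ.- + (m * nE)) ℤ.+ + (m * nF)                        ≡⟨ cong₂ ℤ._+_ (cong₂ ℤ._-_ (ℤ.pos-* m nV) (ℤ.pos-* m nE)) (ℤ.pos-* m nF) ⟩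
    (+ m ℤ.* + nV ℤ.- + m ℤ.* + nE) ℤ.+ + m ℤ.* + nF                  ≡⟨ distribute (+ m) (+ nV) (+ nE) (+ nF) ⟩
    + m ℤ.* χ                                                         ∎
    where
    open ≡-Reasoning
    distribute : ∀ k v e f → (k ℤ.* v ℤ.- k ℤ.* e) ℤ.+ k ℤ.* f ≡ k ℤ.* ((v ℤ.- e) ℤ.+ f)
    distribute = solve-∀

-- Identification with the glued copies of the cut map.

module CyclicCover (K : PolyhedralMap) (C : Cycle K) (cut : Cut K C)
  (uncut-connected : ∀ f g → Star (NonSeparating.Crossable K C) f g) (n : ℕ) where
  open PolyhedralMap K
  open MapFacts K using (Joins-ends; Joins-sym; ⊂ᶠ⇒∈ᶠ; first)
  open AlongCycle K C using (edge; edge-joins; edge-EdgeOf; EdgeOf?)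
  open NonSeparating K C using (left; right; left-right)
  open Cycle C renaming (length to len; injective to at-injective)
  open Cut cut

  isB : Side K C → Bool
  isB A = false
  isB B = true

  sheet-shift : Face → (v : Vertex) → Dec (OnCycle v) → Bool
  sheet-shift f v (yes (j , _)) = isB (side j f)
  sheet-shift f v (no _)        = false

  -- In the copy of f on sheet i, a vertex of C on the B-side is glued to sheet i + 1.
  s : Face → Vertex → Bool
  s f v = sheet-shift f v (any? (λ j → at j ≟ v))

  s-at : ∀ f j → s f (at j) ≡ isB (side j f)
  s-at f j with any? (λ i → at i ≟ at j)
  ... | yes (i , eq) = cong (λ i → isB (side i f)) (at-injective eq)
  ... | no  none     = ⊥-elim (none (j , refl))

  s-same : ∀ {e f g u} → Across e f g → ¬ EdgeOf e → u ∈ᵉ e → s f u ≡ s g u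
  s-same {e} {f} {g} {u} ac ¬E u∈e with any? (λ i → at i ≟ u)
  ... | yes (j , eq) = cong isB (same j e f g ac (subst (_∈ᵉ e) (sym eq) u∈e) ¬E)
  ... | no  _        = refl

  s-along : ∀ {e f j} → e ⊂ᶠ f → Joins e (at j) (at (next j)) → s f (at j) ≡ s f (at (next j))
  s-along {e} {f} {j} e⊂f joins = trans (s-at f j) (trans (cong isB (along j e f e⊂f joins)) (sym (s-at f (next j))))

  -- Off C this is the condition `same` of the cut, on C the condition `along`.
  compatible : ∀ {e u v f g} → Joins e u v → e ⊂ᶠ f → e ⊂ᶠ g →
               (s f u ≡ s g u × s f v ≡ s g v) ⊎ (s f u ≡ s f v × s g u ≡ s g v)
  compatible {e} {u} {v} {f} {g} uv e⊂f e⊂g with f ≟ g | EdgeOf? e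
  ... | yes refl | _ = inj₁ (refl , refl)
  ... | no f≢g | no ¬E = inj₁ (s-same (f≢g , e⊂f , e⊂g) ¬E (v , uv) , s-same (f≢g , e⊂f , e⊂g) ¬E (u , Joins-sym uv))
  ... | no f≢g | yes (j , joins) with Joins-ends joins uv
  ...   | inj₁ (refl , refl) = inj₂ (s-along e⊂f joins , s-along e⊂g joins)
  ...   | inj₂ (refl , refl) = inj₂ (sym (s-along e⊂f joins) , sym (s-along e⊂g joins))

  chain : ∀ f g → Star (λ f g → ∃[ u ] (u ∈ᶠ f × u ∈ᶠ g × s f u ≡ s g u)) f g
  chain f g = Star.map (λ (e , ac@(_ , e⊂f , e⊂g) , ¬E) →
    let j = inj₁ refl in
    proj₁ (ends e) , ⊂ᶠ⇒∈ᶠ e⊂f j , ⊂ᶠ⇒∈ᶠ e⊂g j , s-same ac ¬E (_ , j)) (uncut-connected f g)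

  -- Any edge of C serves: its two faces get opposite sides, and they are ordered with the A-side
  -- first.
  climb : ∃[ u ] ∃[ f ] ∃[ g ] (u ∈ᶠ f × u ∈ᶠ g × s f u ≡ false × s g u ≡ true)
  climb = pick (side j (left e)) (side j (right e)) refl refl
    (opposite j e (left e) (right e) (left-right e) (_ , edge-joins j) (edge-EdgeOf j))
    where
    j : Fin len
    j = first length≥3
    e = edge j
    in-left : at j ∈ᶠ left e
    in-left = ⊂ᶠ⇒∈ᶠ (proj₁ (proj₂ (left-right e))) (edge-joins j)
    in-right : at j ∈ᶠ right e
    in-right = ⊂ᶠ⇒∈ᶠ (proj₂ (proj₂ (left-right e))) (edge-joins j)
    pick : ∀ x y → side j (left e) ≡ x → side j (right e) ≡ y → side j (left e) ≢ side j (right e) →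
           ∃[ u ] ∃[ f ] ∃[ g ] (u ∈ᶠ f × u ∈ᶠ g × s f u ≡ false × s g u ≡ true)
    pick A B l≡ r≡ _  = at j , left e , right e , in-left , in-right ,
      trans (s-at (left e) j) (cong isB l≡) , trans (s-at (right e) j) (cong isB r≡)
    pick B A l≡ r≡ _  = at j , right e , left e , in-right , in-left ,
      trans (s-at (right e) j) (cong isB r≡) , trans (s-at (left e) j) (cong isB l≡)
    pick A A l≡ r≡ ne = ⊥-elim (ne (trans l≡ (sym r≡)))
    pick B B l≡ r≡ ne = ⊥-elim (ne (trans l≡ (sym r≡)))

  open Cover K n s compatible chain climb public

  vertexMap : Fin m × CutVertex K C → Fin (m * nV)
  vertexMap (i , inner v _) = combine i v
  vertexMap (i , p j)       = combine i (at j)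
  vertexMap (i , q j)       = combine (next i) (at j)

  vertexMap-onto : ∀ i v → ∃[ x ] vertexMap (i , x) ≡ combine i v
  vertexMap-onto i v with any? (λ j → at j ≟ v)
  ... | yes (j , refl) = p j , refl
  ... | no  v∉C        = inner v v∉C , refl

  _~_ : Fin m × CutVertex K C → Fin m × CutVertex K C → Set
  _~_ = EqClosure (Glue K C)

  -- Every gluing class has one representative that is not a `q`, obtained by passing to the `p` of
  -- the next sheet. On these representatives `vertexMap` is injective, which identifies its kernel
  -- with the gluing.
  data Canonical : Fin m × CutVertex K C → Set where
    inner : ∀ i v .(v∉C : ¬ OnCycle v) → Canonical (i , inner v v∉C)
    p     : ∀ i j → Canonical (i , p j)

  canonical : ∀ x → ∃[ y ] (Canonical y × x ~ y × vertexMap x ≡ vertexMap y)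
  canonical (i , inner v v∉C) = _ , inner i v v∉C , ε , refl
  canonical (i , p j)         = _ , p i j , ε , refl
  canonical (i , q j)         = _ , p (next i) j , fwd (glue i j) ◅ ε , refl

  canonical-injective : ∀ {x y} → Canonical x → Canonical y → vertexMap x ≡ vertexMap y → x ≡ y
  canonical-injective (inner i v _) (inner i′ v′ _) eq with combine-injective i v i′ v′ eq
  ... | refl , refl = refl
  canonical-injective (inner i v v∉C) (p i′ j) eq with combine-injective i v i′ (at j) eq
  ... | refl , refl = ⊥-elim-irr (v∉C (j , refl))
  canonical-injective (p i j) (inner i′ v v∉C) eq with combine-injective i (at j) i′ v eq
  ... | refl , refl = ⊥-elim-irr (v∉C (j , refl))
  canonical-injective (p i j) (p i′ j′) eq with combine-injective i (at j) i′ (at j′) eq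
  ... | refl , eq′ = cong (λ j → i , p j) (at-injective eq′)

  glued : ∀ x y → vertexMap x ≡ vertexMap y → x ~ y
  glued x y eq with canonical x | canonical y
  ... | x′ , cx , x~ , ex | y′ , cy , y~ , ey
    with canonical-injective cx cy (trans (sym ex) (trans eq ey))
  ... | refl = x~ ◅◅ EqClosure.symmetric (Glue K C) y~

  respects : ∀ {x y} → x ~ y → vertexMap x ≡ vertexMap y
  respects ε                       = refl
  respects (fwd (glue i j) ◅ rest) = respects rest
  respects (bwd (glue i j) ◅ rest) = respects rest

  -- Both descriptions put a B-side vertex of C one level up: `shift` on the left, the glued `q` on
  -- the right.
  place-relabel : ∀ f i v (dec : Dec (OnCycle v)) →
                  combine (shift (sheet-shift f v dec) i) v ≡ vertexMap (i , relabel K C cut f v dec)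
  place-relabel f i v (no _) = refl
  place-relabel f i v (yes (j , refl)) with side j f
  ... | A = refl
  ... | B = refl

  covering : NonTrivial K C → IsCoveringMap m K Kᵐ
  covering nontrivial = record
    { C                    = C
    ; nontrivial           = nontrivial
    ; divides              = AlongCycle.divides-face-cycles K C
    ; cut                  = cut
    ; vertexMap            = vertexMap
    ; vertexMap-surjective = λ V → let x , eq = vertexMap-onto (level V) (base V) in
        (level V , x) , λ { refl → trans eq (combine-remQuot {m} nV V) }
    ; vertexMap-kernel     = λ x y → mk⇔ (glued x y) respects
    ; faceMap              = ↔⇒⤖ (↔-sym *↔×)
    -- Lifted faces keep the numbering of their corners, so the lists are equal and the rotation is
    -- trivial.
    ; faceMap-boundary     = λ i f → inj₁ ([] , _ , refl , trans
        (sym (trans (cong (λ (i , f) → tabulate λ k → place f i (boundary f k)) (remQuot-combine i f))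
                    (tabulate-cong λ k → place-relabel f i (boundary f k) (any? (λ j → at j ≟ boundary f k)))))
        (sym (++-identityʳ _))) }

theorem1p1 : (X : VertexType) (K : PolyhedralMap) →
    IsSemiEquivelar X K →
    PolyhedralMap.χ K ≡ - (+ 2) →
    (m : ℕ) → 2 ≤ m →
    ∃[ Kᵐ ] (IsSemiEquivelar X Kᵐ × IsCoveringMap m K Kᵐ × PolyhedralMap.χ Kᵐ ≡ - (+ (2 * m)))
theorem1p1 X K semi χ≡-2 (suc n) _ = Kᵐ , same-type X semi , covering C-non-trivial , (begin
  PolyhedralMap.χ Kᵐ           ≡⟨ χ-cover ⟩
  + suc n ℤ.* PolyhedralMap.χ K ≡⟨ cong (+ suc n ℤ.*_) χ≡-2 ⟩
  + suc n ℤ.* - (+ 2)          ≡⟨ ℤ.neg-distribʳ-* (+ suc n) (+ 2) ⟨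
  - (+ suc n ℤ.* + 2)          ≡⟨ cong -_ (ℤ.pos-* (suc n) 2) ⟨
  - (+ (suc n * 2))            ≡⟨ cong (λ k → - (+ k)) (ℕ.*-comm (suc n) 2) ⟩
  - (+ (2 * suc n))            ∎)
  where
  open ≡-Reasoning
  open Homology K χ≡-2
  open CyclicCover K C cut C-connected n
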